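{- Let $\sigma\in\mathfrak{S}_n$ and $t\in\mathcal{Y}_n$. Then $$\Lambda(M_\sigma)=\begin{cases}M_{\lambda(\sigma)}&\text{if }\sigma\text{ is }132\text{ -avoiding},\\0&\text{otherwise,}\end{cases}\qquad \mathcal{L}(M_t)=\begin{cases}M_{L(t)}&\text{if }t=C(\mathsf{S})\text{ for some }\mathsf{S}\in\mathcal{Q}_n,\\0&\text{otherwise.}\end{cases}$$
   Context: $\mathfrak{S}_n$: permutations of $[n]$ with weak order ($\sigma\leq\tau$ iff the inversion set of $\sigma$ is contained in that of $\tau$). $\sigma$ is 132-avoiding if there are no $i<j<k$ with $\sigma(i)<\sigma(k)<\sigma(j)$. For $\sigma\in\mathfrak{S}_p,\tau\in\mathfrak{S}_q$: $\sigma\vee\tau$ has values $\sigma(1)+q,\dots,\sigma(p)+q,p+q+1,\tau(1),\dots,\tau(q)$. $\mathcal{Y}_n$: rooted planar binary trees with $n$ internal nodes, $\mathcal{Y}_0=\{|\}$, each $t$ uniquely $t_l\vee t_r$; Tamari order generated by $(A\vee B)\vee C\to A\vee(B\vee C)$ on subtrees. $1_0=|$, $1_n=1_{n-1}\vee|$; $|\backslash t=t$, $s\backslash t=s_l\vee(s_r\backslash t)$. $\mathcal{Q}_n$: subsets of $[n-1]$ under inclusion. $\lambda\colon\mathfrak{S}_n\to\mathcal{Y}_n$: $\lambda(\mathrm{id}_0)=|$, $\lambda(\sigma)=\lambda(\mathrm{st}(\sigma(1..j-1)))\vee\lambda(\mathrm{st}(\sigma(j+1..n)))$ where $j=\sigma^{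 -1}(n)$ and st denotes standardization. For $\mathsf{S}=\{p_1<\dots<p_k\}$, $C(\mathsf{S})=1_{p_1}\backslash1_{p_2-p_1}\backslash\cdots\backslash1_{n-p_k}$. $L(t)$: numbering leaves of $t\in\mathcal{Y}_n$ as $0,\dots,n$ left to right, $L(t)$ is the set of $i\in[n-1]$ with leaf $i$ a left child. Hopf algebras (over $\mathbb{Q}$): $\mathfrak{S}Sym$ has basis $\{F_\sigma\}$ over all permutations, $\mathcal{Y}Sym$ has basis $\{F_t\}$ over all planar binary trees, $\mathcal{Q}Sym$ (quasi-symmetric functions) has in degree $n$ the fundamental basis $F_\mathsf{S}$ and monomial basis $M_\mathsf{S}$, $\mathsf{S}\subseteq[n-1]$, with $F_\mathsf{S}=\sum_{\mathsf{T}\supseteq\mathsf{S}}M_\mathsf{T}$. Monomial bases: $M_\sigma=\sum_{\tau\geq\sigma}\mu_{\mathfrak{S}_n}(\sigma,\tau)F_\tau$ and $M_t=\sum_{s\geq t}\mu_{\mathcal{Y}_n}(t,s)F_s$ ($\mu$ the Möbius functions of the weak and Tamari orders), equivalently $F_\sigma=\sum_{\tau\ge\sigma}M_\tau$, $F_t=\sum_{s\geq t}M_s$. The linear maps $\Lambda\colon\mathfrak{S}Sym\to\mathcal{Y}Sym$, $F_\sigma\mapsto F_{\lambda(\sigma)}$, and $\mathcal{L}\colon\mathcal{Y}Sym\to\mathcal{Q}Sym$, $F_t\mapsto F_{L(t)}$. -}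

module Defs where

open import Data.Bool using (Bool; true; false; if_then_else_; _∧_; _∨_; not)
open import Data.Nat using (ℕ; zero; suc; _∸_; _<ᵇ_; _≡ᵇ_)
import Data.Nat as ℕ
open import Data.Nat.Properties using () renaming (_≟_ to _≟ℕ_)
open import Data.List using (List; []; _∷_; _++_; map; concatMap; length; foldr; zip; upTo; takeWhile; drop; lookup; filter)
open import Data.List.Properties using (≡-dec)
open import Data.Product using (_×_; _,_; proj₁; proj₂; ∃)
open import Data.Fin using (Fin)
import Data.Fin as Fin
open import Data.Rational using (ℚ; 0ℚ; 1ℚ; _+_; -_)
open import Relation.Nullary using (¬_; Dec; yes; no)
open import Relation.Nullary.Decidable using (⌊_⌋)
open import Relation.Binary using (Rel; Decidable)
open import Relation.Binary.PropositionalEquality using (_≡_; refl; cong₂)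
open import Relation.Binary.Construct.Closure.ReflexiveTransitive using (Star)

filterB : {A : Set} → (A → Bool) → List A → List A
filterB p [] = []
filterB p (x ∷ xs) = if p x then x ∷ filterB p xs else filterB p xs

anyB : {A : Set} → (A → Bool) → List A → Bool
anyB p = foldr (λ x b → p x ∨ b) false

allB : {A : Set} → (A → Bool) → List A → Bool
allB p = foldr (λ x b → p x ∧ b) true

sumℚ : List ℚ → ℚ
sumℚ = foldr _+_ 0ℚ

eqℕ : ℕ → ℕ → Bool
eqℕ m n = m ≡ᵇ n

eqList : List ℕ → List ℕ → Bool
eqList u v = ⌊ ≡-dec _≟ℕ_ u v ⌋

oneTo : ℕ → List ℕ
oneTo m = map suc (upTo m)

-- Formal Q-linear combinations of basis elements of type B.
-- An element is a finite list of (coefficient , basis element); two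
-- combinations are equal iff every basis element has the same total
-- coefficient (this is the free Q-vector space on B).

LC : Set → Set
LC B = List (ℚ × B)

coeff : {B : Set} → (B → B → Bool) → B → LC B → ℚ
coeff eq b v = sumℚ (map proj₁ (filterB (λ p → eq (proj₂ p) b) v))

EqLC : {B : Set} → (B → B → Bool) → LC B → LC B → Set
EqLC {B} eq v w = (b : B) → coeff eq b v ≡ coeff eq b w

linMap : {A B : Set} → (A → B) → LC A → LC B
linMap f = map (λ p → proj₁ p , f (proj₂ p))

-- Möbius function of a finite poset given by the list of its elements,
-- a boolean order relation and boolean equality.
-- mu x y = 1 if x = y, = - Σ_{x ≤ z < y} mu x z if x < y, and 0 otherwise.
-- The recursion is on a fuel parameter; fuel = number of elements is
-- enough since every strict chain has at most that many elements.

module Poset {A : Set} (elems : List A) (leq eq : A → A → Bool) where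

  muF : ℕ → A → A → ℚ
  muF zero x y = 0ℚ
  muF (suc k) x y =
    if eq x y then 1ℚ
    else if leq x y
      then - sumℚ (map (muF k x)
               (filterB (λ z → leq x z ∧ (leq z y ∧ not (eq z y))) elems))
      else 0ℚ

  mu : A → A → ℚ
  mu = muF (length elems)

  -- monomial basis element M_x = Σ_{y ≥ x} mu(x,y) F_y, as a combination
  -- of fundamental basis elements F_y (identified with y)
  Mono : A → LC A
  Mono x = map (λ y → mu x y , y) (filterB (leq x) elems)

-- Permutations of [n], as lists of their values σ(1), ..., σ(n).

insertAll : ℕ → List ℕ → List (List ℕ)
insertAll a [] = (a ∷ []) ∷ []
insertAll a (x ∷ xs) = (a ∷ x ∷ xs) ∷ map (x ∷_) (insertAll a xs)

perms : ℕ → List (List ℕ)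
perms zero = [] ∷ []
perms (suc n) = concatMap (insertAll (suc n)) (perms n)

invs : List ℕ → List (ℕ × ℕ)
invs σ = concatMap (λ p → concatMap (λ q →
            if (proj₁ p <ᵇ proj₁ q) ∧ (proj₂ q <ᵇ proj₂ p)
              then (proj₁ p , proj₁ q) ∷ [] else []) ps) ps
  where ps = zip (upTo (length σ)) σ

memPair : ℕ × ℕ → List (ℕ × ℕ) → Bool
memPair (i , j) = anyB (λ p → eqℕ i (proj₁ p) ∧ eqℕ j (proj₂ p))

weakLeq : List ℕ → List ℕ → Bool
weakLeq σ τ = allB (λ p → memPair p (invs τ)) (invs σ)

Avoids132 : List ℕ → Set
Avoids132 σ = ¬ (∃ λ (i : Fin (length σ)) → ∃ λ (j : Fin (length σ)) → ∃ λ (k : Fin (length σ)) →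
  (i Fin.< j) × (j Fin.< k) × (lookup σ i ℕ.< lookup σ k) × (lookup σ k ℕ.< lookup σ j))

st : List ℕ → List ℕ
st w = map (λ x → suc (length (filterB (λ y → y <ᵇ x) w))) w

data Tree : Set where
  leaf : Tree
  _∨T_ : Tree → Tree → Tree

size : Tree → ℕ
size leaf = 0
size (l ∨T r) = suc (size l ℕ.+ size r)

_≟T_ : (s t : Tree) → Dec (s ≡ t)
leaf ≟T leaf = yes refl
leaf ≟T (_ ∨T _) = no (λ ())
(_ ∨T _) ≟T leaf = no (λ ())
(a ∨T b) ≟T (c ∨T d) with a ≟T c | b ≟T d
... | yes refl | yes refl = yes refl
... | no p | _ = no (λ { refl → p refl })
... | yes _ | no q = no (λ { refl → q refl })

eqT : Tree → Tree → Bool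
eqT s t = ⌊ s ≟T t ⌋

-- trees of size k, with fuel f ≥ k
treesF : ℕ → ℕ → List Tree
treesF _ zero = leaf ∷ []
treesF zero (suc k) = []
treesF (suc f) (suc k) =
  concatMap (λ i → concatMap (λ l → map (l ∨T_) (treesF f (k ∸ i))) (treesF f i)) (upTo (suc k))

trees : ℕ → List Tree
trees n = treesF n n

data _⟶T_ : Tree → Tree → Set where
  rot : ∀ {a b c} → ((a ∨T b) ∨T c) ⟶T (a ∨T (b ∨T c))
  inl : ∀ {a a′ b} → a ⟶T a′ → (a ∨T b) ⟶T (a′ ∨T b)
  inr : ∀ {a b b′} → b ⟶T b′ → (a ∨T b) ⟶T (a ∨T b′)

_≤T_ : Tree → Tree → Set
_≤T_ = Star _⟶T_

comb : ℕ → Tree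
comb zero = leaf
comb (suc n) = comb n ∨T leaf

_under_ : Tree → Tree → Tree
leaf under t = t
(l ∨T r) under t = l ∨T (r under t)

-- λ : 𝔖_n → 𝒴_n (with fuel = length, which suffices)
lamF : ℕ → List ℕ → Tree
lamF zero w = leaf
lamF (suc f) [] = leaf
lamF (suc f) w@(_ ∷ _) =
  lamF f (st left) ∨T lamF f (st (drop (suc (length left)) w))
  where
    n = length w
    left = takeWhile (λ x → Relation.Nullary.¬? (x ≟ℕ n)) w

lam : List ℕ → Tree
lam w = lamF (length w) w

-- Subsets of [n-1], as strictly increasing lists

sublists : List ℕ → List (List ℕ)
sublists [] = [] ∷ []
sublists (x ∷ xs) = map (x ∷_) (sublists xs) ++ sublists xs

subsetsQ : ℕ → List (List ℕ)
subsetsQ n = sublists (oneTo (n ∸ 1))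

subsetLeq : List ℕ → List ℕ → Bool
subsetLeq S T = allB (λ x → anyB (eqℕ x) T) S

C : ℕ → List ℕ → Tree
C n S = go 0 S
  where
    go : ℕ → List ℕ → Tree
    go prev [] = comb (n ∸ prev)
    go prev (p ∷ ps) = comb (p ∸ prev) under go p ps

leafFlags : Bool → Tree → List Bool
leafFlags b leaf = b ∷ []
leafFlags b (l ∨T r) = leafFlags true l ++ leafFlags false r

Lset : Tree → List ℕ
Lset t = map proj₁ (filterB (λ p → (0 <ᵇ proj₁ p) ∧ (proj₁ p <ᵇ size t) ∧ proj₂ p)
                            (zip (upTo (suc (size t))) (leafFlags false t)))

-- The three Hopf algebras in degree n, in their fundamental bases
-- (an element is a linear combination of basis labels; F_x is x itself).

module SSym (n : ℕ) = Poset (perms n) weakLeq eqList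

module YSym (n : ℕ) (_≤T?_ : Decidable _≤T_) =
  Poset (trees n) (λ s t → ⌊ s ≤T? t ⌋) eqT

module QSym (n : ℕ) = Poset (subsetsQ n) subsetLeq eqList

Mσ : ℕ → List ℕ → LC (List ℕ)
Mσ n = SSym.Mono n

Mt : ℕ → Decidable _≤T_ → Tree → LC Tree
Mt n d = YSym.Mono n d

MS : ℕ → List ℕ → LC (List ℕ)
MS n = QSym.Mono n

Λ : LC (List ℕ) → LC Tree
Λ = linMap lam

𝓛 : LC Tree → LC (List ℕ)
𝓛 = linMap Lset

_≈Y_ : LC Tree → LC Tree → Set
_≈Y_ = EqLC eqT

_≈Q_ : LC (List ℕ) → LC (List ℕ) → Set
_≈Q_ = EqLC eqList

{-# OPTIONS --safe #-}
module Submission where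

-- Both cases are Rota's theorem on Galois connections.  If f : P → Q and g : Q → P satisfy
-- f x ≤ w ⇔ x ≤ g w, then summing μ_P(x, y) over the y with f y ≤ w gives the sum over y ≤ g w,
-- which is 1 if x = g w and 0 otherwise.  When moreover f ∘ g = id, Möbius inversion on Q shows
-- that the linear map F_y ↦ F_(f y) sends M_x to M_(f x) if x lies in the image of g, and to 0 if not.
-- For Λ the right adjoint of λ sends t to the largest permutation with tree t, and the image
-- consists of the 132-avoiding permutations; for 𝓛 the right adjoint of L is C.
-- The adjunction for λ goes through words whose letters, read in-order on the nodes of t,
-- increase from each left subtree to its root: this condition says σ ≤ g t, is preserved by
-- rotations, and by splitting at the largest letter it forces λ(σ) ≤ t.

open import Defs
open import Data.Nat using (ℕ)
open import Data.List using (List; [])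
open import Data.List.Membership.Propositional using (_∈_)
open import Data.List.Relation.Binary.Permutation.Propositional using (_↭_)
open import Data.Product using (_×_; ∃)
open import Relation.Nullary using (¬_)
open import Relation.Binary using (Decidable)
open import Relation.Binary.PropositionalEquality
open import Algebra.Properties.Group using (∙-cancelˡ)
open import Data.Bool using (Bool; true; false; if_then_else_; _∧_; not; T; f≤t; b≤b) renaming (_≤_ to _≤𝔹_)
import Data.Bool.Properties as 𝔹ₚ
import Data.Fin as Fin
open import Data.List using (_∷_; _++_; map; length; concatMap; upTo; applyUpTo; zip; takeWhile; drop; lookup)
import Data.List.Properties as Listₚ
open import Data.List.Membership.DecPropositional using (_∈?_)
open import Data.List.Membership.Propositional using (_∉_; find; lose)
import Data.List.Membership.Propositional.Properties as ∈ₚ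
open import Data.List.Relation.Binary.Permutation.Propositional as ↭ using (↭-sym; ↭-trans; ↭-refl; ↭-reflexive; prep; swap; ↭⇒↭ₛ)
import Data.List.Relation.Binary.Permutation.Propositional.Properties as ↭ₚ
import Data.List.Relation.Binary.Permutation.Setoid.Properties as ↭ₛₚ
open import Data.List.Relation.Binary.Pointwise as Pointwise using (Pointwise; []; _∷_)
open import Data.List.Relation.Binary.Sublist.Propositional using (_⊆_; []; _∷_; _∷ʳ_; from∈; to∈)
import Data.List.Relation.Binary.Sublist.Propositional.Properties as ⊆ₚ
open import Data.List.Relation.Unary.All as All using (All; []; _∷_)
import Data.List.Relation.Unary.All.Properties as Allₚ
open import Data.List.Relation.Unary.AllPairs using ([]; _∷_)
open import Data.List.Relation.Unary.Any using (here; there)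
open import Data.List.Relation.Unary.Unique.Propositional using (Unique)
import Data.List.Relation.Unary.Unique.Propositional.Properties as Uniqueₚ
open import Data.Nat using (zero; suc; z≤n; s≤s; s≤s⁻¹; z<s; s<s; s<s⁻¹; _≤_; _<_; _∸_; _<ᵇ_; _≡ᵇ_)
import Data.Nat as ℕ
import Data.Nat.Properties as ℕₚ
open import Data.Product using (_,_; proj₁; proj₂)
open import Data.Rational using (ℚ; 0ℚ; 1ℚ; _+_; -_)
import Data.Rational.Properties as ℚₚ
open import Data.Sum using (inj₁; inj₂)
open import Function using (_∘_; id; Equivalence)
open import Relation.Binary using (Tri; tri<; tri≈; tri>)
open import Relation.Binary.Construct.Closure.ReflexiveTransitive using (ε; _◅_; _◅◅_; gmap)
open import Relation.Nullary using (Dec; yes; no; ¬?; contradiction)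
open import Relation.Nullary.Decidable using (⌊_⌋)

-- Sums and the Möbius function of a finite poset

-- The adjunction for L rests on reading the flags of leaves 1, ..., n as a Boolean word ending in
-- `false`. Inclusion of subsets becomes the pointwise order on words, rotations can only raise
-- flags, and conversely a tree whose flags lie below a word lies below `maxTree` of that word. The
-- converse peels off leaf 0, which matches the recursion on words. On the other side, `lam`
-- restandardizes at every node and runs on fuel, which hides its structure. It is replaced by its
-- graph `LamGraph` on words that need not be standardized; order-preserving relabellings then
-- account both for `st` and for the shifted blocks of `maxPerm`. For the same reason the weak order
-- is replaced by `⊑`, which makes sense for all words of equal length and so restricts to blocks.
-- Equality of linear combinations is tested at every label of the ambient type. The Möbius argument
-- works inside degree n only; elsewhere both coefficients vanish because no listed element meets
-- the label.

∑ : {A : Set} → List A → (A → ℚ) → ℚ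
∑ es f = sumℚ (map f es)

infixr 7 _⊙_

-- Conditions on a summation index are kept as indicators over the full list instead of filtered
-- lists, so that double sums range over two fixed lists and can be interchanged.
_⊙_ : Bool → ℚ → ℚ
b ⊙ q = if b then q else 0ℚ

⊙-congˡ : ∀ {b c q} → b ≡ c → b ⊙ q ≡ c ⊙ q
⊙-congˡ refl = refl

true≢false : ∀ {b} → b ≡ true → b ≡ false → ∀ {ℓ} {X : Set ℓ} → X
true≢false refl ()

bool-ext : ∀ {b c} → (b ≡ true → c ≡ true) → (c ≡ true → b ≡ true) → b ≡ c
bool-ext {true} f g = sym (f refl)
bool-ext {false} {true} f g = g refl
bool-ext {false} {false} f g = refl

∧-true : ∀ {b c} → b ≡ true → c ≡ true → b ∧ c ≡ true
∧-true refl refl = refl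

∧-true⁻ : ∀ b {c} → b ∧ c ≡ true → b ≡ true × c ≡ true
∧-true⁻ true {true} p = refl , refl

module _ {A : Set} where

  ∑-cong : ∀ (es : List A) {f g} → (∀ {x} → x ∈ es → f x ≡ g x) → ∑ es f ≡ ∑ es g
  ∑-cong [] h = refl
  ∑-cong (e ∷ es) h = cong₂ _+_ (h (here refl)) (∑-cong es (h ∘ there))

  ∑-zero : ∀ (es : List A) {f} → (∀ {x} → x ∈ es → f x ≡ 0ℚ) → ∑ es f ≡ 0ℚ
  ∑-zero [] h = refl
  ∑-zero (e ∷ es) h =
    trans (cong₂ _+_ (h (here refl)) (∑-zero es (h ∘ there))) (ℚₚ.+-identityˡ 0ℚ)

  ∑-+ : ∀ (es : List A) f g → ∑ es (λ x → f x + g x) ≡ ∑ es f + ∑ es g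
  ∑-+ [] f g = sym (ℚₚ.+-identityˡ 0ℚ)
  ∑-+ (e ∷ es) f g = begin
    (f e + g e) + ∑ es (λ x → f x + g x) ≡⟨ cong ((f e + g e) +_) (∑-+ es f g) ⟩
    (f e + g e) + (F + G)                ≡⟨ ℚₚ.+-assoc (f e) (g e) (F + G) ⟩
    f e + (g e + (F + G))                ≡⟨ cong (f e +_) (sym (ℚₚ.+-assoc (g e) F G)) ⟩
    f e + ((g e + F) + G)                ≡⟨ cong (λ q → f e + (q + G)) (ℚₚ.+-comm (g e) F) ⟩
    f e + ((F + g e) + G)                ≡⟨ cong (f e +_) (ℚₚ.+-assoc F (g e) G) ⟩
    f e + (F + (g e + G))                ≡⟨ sym (ℚₚ.+-assoc (f e) F (g e + G)) ⟩
    (f e + F) + (g e + G)                ∎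
    where
      open ≡-Reasoning
      F = ∑ es f
      G = ∑ es g

  ∑-single : ∀ {es : List A} {x} f → Unique es → x ∈ es →
             (∀ {y} → y ∈ es → y ≢ x → f y ≡ 0ℚ) → ∑ es f ≡ f x
  ∑-single {e ∷ es} f (e∉ ∷ _) (here refl) h =
    trans (cong (f e +_) (∑-zero es λ y∈ → h (there y∈) (≢-sym (All.lookup e∉ y∈))))
          (ℚₚ.+-identityʳ (f e))
  ∑-single {e ∷ es} f (e∉ ∷ u) (there x∈) h =
    trans (cong₂ _+_ (h (here refl) (All.lookup e∉ x∈)) (∑-single f u x∈ (h ∘ there)))
          (ℚₚ.+-identityˡ _)

  ∑-filter : ∀ (es : List A) p f → sumℚ (map f (filterB p es)) ≡ ∑ es (λ x → p x ⊙ f x)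
  ∑-filter [] p f = refl
  ∑-filter (e ∷ es) p f with p e
  ... | true = cong (f e +_) (∑-filter es p f)
  ... | false = trans (∑-filter es p f) (sym (ℚₚ.+-identityˡ _))

  ⊙-∑ : ∀ b (es : List A) f → b ⊙ ∑ es f ≡ ∑ es (λ x → b ⊙ f x)
  ⊙-∑ true es f = refl
  ⊙-∑ false es f = sym (∑-zero es λ _ → refl)

  filterB-length-≤ : ∀ (es : List A) {p q} → (∀ {x} → x ∈ es → p x ≡ true → q x ≡ true) →
                     length (filterB p es) ≤ length (filterB q es)
  filterB-length-≤ [] h = z≤n
  filterB-length-≤ (e ∷ es) {p} {q} h with p e in pe | q e in qe
  ... | true  | true  = s≤s (filterB-length-≤ es (h ∘ there))
  ... | true  | false = true≢false (h (here refl) pe) qe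
  ... | false | true  = ℕₚ.m≤n⇒m≤1+n (filterB-length-≤ es (h ∘ there))
  ... | false | false = filterB-length-≤ es (h ∘ there)

  filterB-length-< : ∀ {es : List A} {p q x} → x ∈ es → p x ≡ false → q x ≡ true →
                     (∀ {y} → y ∈ es → p y ≡ true → q y ≡ true) →
                     length (filterB p es) < length (filterB q es)
  filterB-length-< {e ∷ es} (here refl) pf qt h rewrite pf | qt =
    s≤s (filterB-length-≤ es (h ∘ there))
  filterB-length-< {e ∷ es} {p} {q} (there x∈) pf qt h with p e in pe | q e in qe
  ... | true  | true  = s≤s (filterB-length-< x∈ pf qt (h ∘ there))
  ... | true  | false = true≢false (h (here refl) pe) qe
  ... | false | true  = ℕₚ.m≤n⇒m≤1+n (filterB-length-< x∈ pf qt (h ∘ there))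
  ... | false | false = filterB-length-< x∈ pf qt (h ∘ there)

  filterB-length-pos : ∀ {es : List A} {p x} → x ∈ es → p x ≡ true → 0 < length (filterB p es)
  filterB-length-pos (here refl) pt rewrite pt = s≤s z≤n
  filterB-length-pos {e ∷ es} {p} (there x∈) pt with p e
  ... | true = s≤s z≤n
  ... | false = filterB-length-pos x∈ pt

  filterB-length-≤-length : ∀ (es : List A) p → length (filterB p es) ≤ length es
  filterB-length-≤-length [] p = z≤n
  filterB-length-≤-length (e ∷ es) p with p e
  ... | true = s≤s (filterB-length-≤-length es p)
  ... | false = ℕₚ.m≤n⇒m≤1+n (filterB-length-≤-length es p)

∑-swap : ∀ {A B : Set} (es : List A) (fs : List B) (g : A → B → ℚ) →
         ∑ es (λ x → ∑ fs (g x)) ≡ ∑ fs (λ y → ∑ es (λ x → g x y))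
∑-swap [] fs g = sym (∑-zero fs λ _ → refl)
∑-swap (e ∷ es) fs g =
  trans (cong (∑ fs (g e) +_) (∑-swap es fs g)) (sym (∑-+ fs (g e) _))

coeff-linMap : ∀ {A B : Set} (eq : B → B → Bool) b (f : A → B) (es : List A) p (c : A → ℚ) →
               coeff eq b (linMap f (map (λ y → c y , y) (filterB p es)))
               ≡ ∑ es (λ y → p y ⊙ eq (f y) b ⊙ c y)
coeff-linMap eq b f [] p c = refl
coeff-linMap eq b f (e ∷ es) p c with p e
... | false = trans (coeff-linMap eq b f es p c) (sym (ℚₚ.+-identityˡ _))
... | true with eq (f e) b
...   | true = cong (c e +_) (coeff-linMap eq b f es p c)
...   | false = trans (coeff-linMap eq b f es p c) (sym (ℚₚ.+-identityˡ _))

-- The order laws are restricted to listed elements because `weakLeq` sees only inversion sets and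
-- is not antisymmetric on arbitrary words: the one-letter words 1 and 2 are below each other. The
-- laws of `eq` hold everywhere, since `EqLC` also tests labels outside the list.
record IsFinitePoset {A : Set} (es : List A) (leq eq : A → A → Bool) : Set where
  field
    unique  : Unique es
    eq-refl : ∀ {x} → eq x x ≡ true
    eq⇒≡    : ∀ {x y} → eq x y ≡ true → x ≡ y
    reflex  : ∀ {x} → x ∈ es → leq x x ≡ true
    transit : ∀ {x y z} → x ∈ es → y ∈ es → z ∈ es →
              leq x y ≡ true → leq y z ≡ true → leq x z ≡ true
    antisym : ∀ {x y} → x ∈ es → y ∈ es → leq x y ≡ true → leq y x ≡ true → x ≡ y

module Möbius {A : Set} {es : List A} {leq eq : A → A → Bool} (P : IsFinitePoset es leq eq) where

  open IsFinitePoset P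
  open Poset es leq eq

  lt : A → A → Bool
  lt x y = leq x y ∧ not (eq x y)

  ≢⇒eq-false : ∀ {x y} → x ≢ y → eq x y ≡ false
  ≢⇒eq-false {x} {y} x≢y with eq x y in e
  ... | true = contradiction (eq⇒≡ e) x≢y
  ... | false = refl

  lt⇒leq : ∀ {x y} → lt x y ≡ true → leq x y ≡ true
  lt⇒leq {x} {y} = proj₁ ∘ ∧-true⁻ (leq x y)

  lt-irrefl : ∀ {x} → lt x x ≡ false
  lt-irrefl {x} rewrite eq-refl {x} with leq x x
  ... | true = refl
  ... | false = refl

  -- The size of the principal lower set. It grows strictly along `lt` and is at most `length es`,
  -- which is why the fuel of `mu` suffices.
  rank : A → ℕ
  rank y = length (filterB (λ u → leq u y) es)

  rank-< : ∀ {z y} → z ∈ es → y ∈ es → lt z y ≡ true → rank z < rank y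
  rank-< {z} {y} z∈ y∈ z<y =
    filterB-length-< y∈ y≰z (reflex y∈) (λ u∈ u≤z → transit u∈ z∈ y∈ u≤z (lt⇒leq z<y))
    where
      y≰z : leq y z ≡ false
      y≰z with leq y z in e
      ... | false = refl
      ... | true with refl ← antisym z∈ y∈ (lt⇒leq z<y) e = true≢false z<y lt-irrefl

  muF-sum : ∀ k x y → sumℚ (map (muF k x) (filterB (λ z → leq x z ∧ lt z y) es))
                      ≡ ∑ es (λ z → (leq x z ∧ lt z y) ⊙ muF k x z)
  muF-sum k x y = ∑-filter es _ (muF k x)

  -- Strict chains ending at y have at most rank y elements, so fuel beyond rank y changes nothing.
  muF-stable : ∀ k k′ {x y} → y ∈ es → rank y ≤ k → rank y ≤ k′ → muF k x y ≡ muF k′ x y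
  muF-stable zero k′ y∈ r r′ = contradiction (filterB-length-pos y∈ (reflex y∈)) (ℕₚ.≤⇒≯ r)
  muF-stable (suc k) zero y∈ r r′ = contradiction (filterB-length-pos y∈ (reflex y∈)) (ℕₚ.≤⇒≯ r′)
  muF-stable (suc k) (suc k′) {x} {y} y∈ r r′ with eq x y
  ... | true = refl
  ... | false with leq x y
  ...   | false = refl
  ...   | true = cong -_ (begin
    sumℚ (map (muF k x) (filterB _ es))          ≡⟨ muF-sum k x y ⟩
    ∑ es (λ z → (leq x z ∧ lt z y) ⊙ muF k x z)  ≡⟨ ∑-cong es step ⟩
    ∑ es (λ z → (leq x z ∧ lt z y) ⊙ muF k′ x z) ≡⟨ sym (muF-sum k′ x y) ⟩
    sumℚ (map (muF k′ x) (filterB _ es))         ∎)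
    where
      open ≡-Reasoning
      step : ∀ {z} → z ∈ es → (leq x z ∧ lt z y) ⊙ muF k x z ≡ (leq x z ∧ lt z y) ⊙ muF k′ x z
      step {z} z∈ with leq x z ∧ lt z y in e
      ... | false = refl
      ... | true =
        let r< = rank-< z∈ y∈ (proj₂ (∧-true⁻ (leq x z) e)) in
        muF-stable k k′ z∈ (s≤s⁻¹ (ℕₚ.≤-trans r< r)) (s≤s⁻¹ (ℕₚ.≤-trans r< r′))

  -- With one more unit of fuel the recursion unfolds once and its inner calls are exactly `mu`.
  mu-suc : ∀ {x y} → y ∈ es → mu x y ≡ muF (suc (length es)) x y
  mu-suc y∈ = muF-stable (length es) (suc (length es)) y∈ r (ℕₚ.m≤n⇒m≤1+n r)
    where r = filterB-length-≤-length es _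

  mu-refl : ∀ {x} → x ∈ es → mu x x ≡ 1ℚ
  mu-refl {x} x∈ rewrite mu-suc {x} x∈ | eq-refl {x} = refl

  mu-< : ∀ {x y} → y ∈ es → x ≢ y → leq x y ≡ true →
         mu x y ≡ - ∑ es (λ z → (leq x z ∧ lt z y) ⊙ mu x z)
  mu-< {x} {y} y∈ x≢y x≤y rewrite mu-suc {x} {y} y∈ | ≢⇒eq-false x≢y | x≤y =
    cong -_ (muF-sum (length es) x y)

  ∑-≤ : ∀ (h : A → ℚ) {y} → y ∈ es → ∑ es (λ z → leq z y ⊙ h z) ≡ ∑ es (λ z → lt z y ⊙ h z) + h y
  ∑-≤ h {y} y∈ = begin
    ∑ es (λ z → leq z y ⊙ h z)                       ≡⟨ ∑-cong es split ⟩
    ∑ es (λ z → lt z y ⊙ h z + eq z y ⊙ h z)         ≡⟨ ∑-+ es _ _ ⟩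
    ∑ es (λ z → lt z y ⊙ h z) + ∑ es (λ z → eq z y ⊙ h z)
      ≡⟨ cong (∑ es (λ z → lt z y ⊙ h z) +_)
           (∑-single _ unique y∈ λ _ z≢y → ⊙-congˡ (≢⇒eq-false z≢y)) ⟩
    ∑ es (λ z → lt z y ⊙ h z) + eq y y ⊙ h y
      ≡⟨ cong (λ b → ∑ es (λ z → lt z y ⊙ h z) + b ⊙ h y) eq-refl ⟩
    ∑ es (λ z → lt z y ⊙ h z) + h y                  ∎
    where
      open ≡-Reasoning
      split : ∀ {z} → z ∈ es → leq z y ⊙ h z ≡ lt z y ⊙ h z + eq z y ⊙ h z
      split {z} z∈ with eq z y in e
      ... | true with refl ← eq⇒≡ e rewrite reflex z∈ = sym (ℚₚ.+-identityˡ _)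
      ... | false with leq z y
      ...   | true = sym (ℚₚ.+-identityʳ _)
      ...   | false = sym (ℚₚ.+-identityʳ _)

  ⊙-∧ : ∀ b c q → (b ∧ c) ⊙ q ≡ c ⊙ b ⊙ q
  ⊙-∧ true c q = refl
  ⊙-∧ false true q = refl
  ⊙-∧ false false q = refl

  -- The recursion for `mu` read as a sum over the interval from `x` to `y`: if `x < y`, the terms
  -- below `y` add up to the negative of the top term; if `x = y`, one term is left; otherwise the
  -- interval is empty.
  ∑-mu : ∀ {x y} → x ∈ es → y ∈ es → ∑ es (λ z → leq z y ⊙ leq x z ⊙ mu x z) ≡ eq x y ⊙ 1ℚ
  ∑-mu {x} {y} x∈ y∈ with eq x y in e
  ... | true with refl ← eq⇒≡ e = begin
    ∑ es (λ z → leq z x ⊙ leq x z ⊙ mu x z) ≡⟨ ∑-single _ unique x∈ other ⟩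
    leq x x ⊙ leq x x ⊙ mu x x              ≡⟨ cong (λ b → b ⊙ b ⊙ mu x x) (reflex x∈) ⟩
    mu x x                                  ≡⟨ mu-refl x∈ ⟩
    1ℚ                                      ∎
    where
      open ≡-Reasoning
      other : ∀ {z} → z ∈ es → z ≢ x → leq z x ⊙ leq x z ⊙ mu x z ≡ 0ℚ
      other {z} z∈ z≢x with leq z x in p | leq x z in q
      ... | false | _ = refl
      ... | true | false = refl
      ... | true | true = contradiction (antisym z∈ x∈ p q) z≢x
  ... | false with leq x y in x≤y
  ...   | false = ∑-zero es between
    where
      between : ∀ {z} → z ∈ es → leq z y ⊙ leq x z ⊙ mu x z ≡ 0ℚ
      between {z} z∈ with leq z y in p | leq x z in q
      ... | false | _ = refl
      ... | true | false = refl
      ... | true | true = true≢false (transit x∈ z∈ y∈ q p) x≤y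
  ...   | true = begin
    ∑ es (λ z → leq z y ⊙ leq x z ⊙ mu x z)
      ≡⟨ ∑-≤ (λ z → leq x z ⊙ mu x z) y∈ ⟩
    ∑ es (λ z → lt z y ⊙ leq x z ⊙ mu x z) + leq x y ⊙ mu x y
      ≡⟨ cong₂ _+_ (∑-cong es λ {z} _ → sym (⊙-∧ (leq x z) (lt z y) _)) (cong (_⊙ mu x y) x≤y) ⟩
    S + mu x y
      ≡⟨ cong (S +_) (mu-< y∈ (λ { refl → true≢false eq-refl e }) x≤y) ⟩
    S + - S
      ≡⟨ ℚₚ.+-inverseʳ S ⟩
    0ℚ ∎
    where
      open ≡-Reasoning
      S = ∑ es (λ z → (leq x z ∧ lt z y) ⊙ mu x z)

  -- The zeta matrix is unitriangular: by induction on `rank` the summands strictly below `y` agree,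
  -- and cancelling them leaves the values at `y`.
  ∑-≤-injective : ∀ (N R : A → ℚ) →
                  (∀ {y} → y ∈ es → ∑ es (λ z → leq z y ⊙ N z) ≡ ∑ es (λ z → leq z y ⊙ R z)) →
                  ∀ {y} → y ∈ es → N y ≡ R y
  ∑-≤-injective N R h {y} y∈ = go (rank y) y∈ ℕₚ.≤-refl
    where
      go : ∀ k {y} → y ∈ es → rank y ≤ k → N y ≡ R y
      go zero y∈ r = contradiction (filterB-length-pos y∈ (reflex y∈)) (ℕₚ.≤⇒≯ r)
      go (suc k) {y} y∈ r = ∙-cancelˡ ℚₚ.+-0-group (∑ es (λ z → lt z y ⊙ N z)) (N y) (R y) (begin
        ∑ es (λ z → lt z y ⊙ N z) + N y ≡⟨ sym (∑-≤ N y∈) ⟩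
        ∑ es (λ z → leq z y ⊙ N z)      ≡⟨ h y∈ ⟩
        ∑ es (λ z → leq z y ⊙ R z)      ≡⟨ ∑-≤ R y∈ ⟩
        ∑ es (λ z → lt z y ⊙ R z) + R y ≡⟨ cong (_+ R y) (∑-cong es (sym ∘ below)) ⟩
        ∑ es (λ z → lt z y ⊙ N z) + R y ∎)
        where
          open ≡-Reasoning
          below : ∀ {z} → z ∈ es → lt z y ⊙ N z ≡ lt z y ⊙ R z
          below {z} z∈ with lt z y in e
          ... | false = refl
          ... | true = go k z∈ (s≤s⁻¹ (ℕₚ.≤-trans (rank-< z∈ y∈ e) r))

  coeff-Mono : ∀ x y → coeff eq y (Mono x) ≡ ∑ es (λ z → leq x z ⊙ eq z y ⊙ mu x z)
  coeff-Mono x y =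
    -- By η for pairs `linMap id` is mapping the identity, so the coefficient formula for
    -- push-forwards applies with `f = id`.
    trans (cong (coeff eq y) (sym (Listₚ.map-id (Mono x)))) (coeff-linMap eq y id es (leq x) (mu x))

-- Push-forward of monomial bases along a Galois connection

module Galois
  {A B : Set} {es : List A} {fs : List B} {leqA eqA : A → A → Bool} {leqB eqB : B → B → Bool}
  (PA : IsFinitePoset es leqA eqA) (PB : IsFinitePoset fs leqB eqB)
  (f : A → B) (g : B → A)
  (f∈ : ∀ {x} → x ∈ es → f x ∈ fs) (g∈ : ∀ {w} → w ∈ fs → g w ∈ es)
  (adjoint : ∀ {x w} → x ∈ es → w ∈ fs → leqB (f x) w ≡ leqA x (g w))
  (f∘g : ∀ {w} → w ∈ fs → f (g w) ≡ w)
  where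

  private
    module MA = Möbius PA
    module MB = Möbius PB
    open IsFinitePoset
    open Poset es leqA eqA using () renaming (mu to muA; Mono to MonoA)
    open Poset fs leqB eqB using () renaming (mu to muB; Mono to MonoB)

  ⊙-comm : ∀ b c q → b ⊙ c ⊙ q ≡ c ⊙ b ⊙ q
  ⊙-comm true c q = refl
  ⊙-comm false true q = refl
  ⊙-comm false false q = refl

  ∑-eval : ∀ {w′} (h : B → ℚ) → w′ ∈ fs → ∑ fs (λ w → eqB w′ w ⊙ h w) ≡ h w′
  ∑-eval {w′} h w′∈ =
    trans (∑-single _ (unique PB) w′∈ λ _ w≢ → ⊙-congˡ (MB.≢⇒eq-false (≢-sym w≢)))
          (cong (_⊙ h w′) (eq-refl PB))

  -- After the interchange of the sums, each `y` contributes through the single label `w = f y`,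
  -- which is listed by `f∈`.
  ∑-image : ∀ (c : A → ℚ) {w′} → w′ ∈ fs →
            ∑ fs (λ w → leqB w w′ ⊙ ∑ es (λ y → eqB (f y) w ⊙ c y)) ≡ ∑ es (λ y → leqB (f y) w′ ⊙ c y)
  ∑-image c {w′} w′∈ = begin
    ∑ fs (λ w → leqB w w′ ⊙ ∑ es (λ y → eqB (f y) w ⊙ c y))
      ≡⟨ ∑-cong fs (λ {w} _ → ⊙-∑ (leqB w w′) es _) ⟩
    ∑ fs (λ w → ∑ es (λ y → leqB w w′ ⊙ eqB (f y) w ⊙ c y))
      ≡⟨ ∑-swap fs es _ ⟩
    ∑ es (λ y → ∑ fs (λ w → leqB w w′ ⊙ eqB (f y) w ⊙ c y))
      ≡⟨ ∑-cong es (λ {y} y∈ → trans (∑-cong fs λ {w} _ → ⊙-comm (leqB w w′) (eqB (f y) w) (c y))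
                                     (∑-eval (λ w → leqB w w′ ⊙ c y) (f∈ y∈))) ⟩
    ∑ es (λ y → leqB (f y) w′ ⊙ c y) ∎
    where open ≡-Reasoning

  image : A → B → ℚ
  image x w = ∑ es (λ y → eqB (f y) w ⊙ leqA x y ⊙ muA x y)

  coeff-image : ∀ x w → coeff eqB w (linMap f (MonoA x)) ≡ image x w
  coeff-image x w = trans (coeff-linMap eqB w f es (leqA x) (muA x))
                          (∑-cong es λ {y} _ → ⊙-comm (leqA x y) (eqB (f y) w) (muA x y))

  -- Rota's formula for Galois connections, summed over w ≤ w′.
  ∑-image-mu : ∀ {x w′} → x ∈ es → w′ ∈ fs →
               ∑ fs (λ w → leqB w w′ ⊙ image x w) ≡ eqA x (g w′) ⊙ 1ℚ
  ∑-image-mu {x} {w′} x∈ w′∈ = begin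
    ∑ fs (λ w → leqB w w′ ⊙ image x w)               ≡⟨ ∑-image _ w′∈ ⟩
    ∑ es (λ y → leqB (f y) w′ ⊙ leqA x y ⊙ muA x y)  ≡⟨ ∑-cong es (λ y∈ → ⊙-congˡ (adjoint y∈ w′∈)) ⟩
    ∑ es (λ y → leqA y (g w′) ⊙ leqA x y ⊙ muA x y)  ≡⟨ MA.∑-mu x∈ (g∈ w′∈) ⟩
    eqA x (g w′) ⊙ 1ℚ                                ∎
    where open ≡-Reasoning

  eqB-false-outside : ∀ {w b} → w ∈ fs → ¬ (b ∈ fs) → eqB w b ≡ false
  eqB-false-outside w∈ b∉ = MB.≢⇒eq-false λ { refl → b∉ w∈ }

  image-outside : ∀ x {b} → ¬ (b ∈ fs) → image x b ≡ 0ℚ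
  image-outside x b∉ = ∑-zero es λ y∈ → ⊙-congˡ (eqB-false-outside (f∈ y∈) b∉)

  private
    _≟B_ : ∀ x y → Dec (x ≡ y)
    x ≟B y with eqB x y in e
    ... | true = yes (eq⇒≡ PB e)
    ... | false = no λ { refl → true≢false (eq-refl PB) e }

  mono : B → B → ℚ
  mono v w = ∑ fs (λ z → leqB v z ⊙ eqB z w ⊙ muB v z)

  mono-inside : ∀ {v w} → w ∈ fs → mono v w ≡ leqB v w ⊙ muB v w
  mono-inside {v} {w} w∈ =
    trans (∑-single _ (unique PB) w∈ λ {z} _ z≢w →
             trans (⊙-comm (leqB v z) (eqB z w) _) (⊙-congˡ (MB.≢⇒eq-false z≢w)))
          (trans (⊙-comm (leqB v w) (eqB w w) _) (⊙-congˡ (eq-refl PB)))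

  Mono-image : ∀ {x} → x ∈ es → x ≡ g (f x) → EqLC eqB (linMap f (MonoA x)) (MonoB (f x))
  Mono-image {x} x∈ x≡gfx b =
    trans (coeff-image x b) (trans image≡mono (sym (MB.coeff-Mono (f x) b)))
    where
      open ≡-Reasoning
      image≡mono : image x b ≡ mono (f x) b
      image≡mono with _∈?_ _≟B_ b fs
      ... | no b∉ = trans (image-outside x b∉) (sym (∑-zero fs λ {z} z∈ →
                      trans (⊙-comm (leqB (f x) z) (eqB z b) _) (⊙-congˡ (eqB-false-outside z∈ b∉))))
      ... | yes b∈ = MB.∑-≤-injective (image x) (mono (f x)) (λ {w′} w′∈ → begin
        ∑ fs (λ w → leqB w w′ ⊙ image x w)
          ≡⟨ ∑-image-mu x∈ w′∈ ⟩
        eqA x (g w′) ⊙ 1ℚ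
          -- Since `x = g (f x)` and `f (g w′) = w′`, the equations `x = g w′` and `f x = w′` are
          -- equivalent.
          ≡⟨ cong (_⊙ 1ℚ) (bool-ext
               (λ e → subst (λ w → eqB (f x) w ≡ true) (trans (cong f (eq⇒≡ PA e)) (f∘g w′∈)) (eq-refl PB))
               (λ e → subst (λ y → eqA x y ≡ true) (trans x≡gfx (cong g (eq⇒≡ PB e))) (eq-refl PA))) ⟩
        eqB (f x) w′ ⊙ 1ℚ
          ≡⟨ sym (MB.∑-mu (f∈ x∈) w′∈) ⟩
        ∑ fs (λ w → leqB w w′ ⊙ leqB (f x) w ⊙ muB (f x) w)
          ≡⟨ ∑-cong fs (λ w∈ → cong (_ ⊙_) (sym (mono-inside w∈))) ⟩
        ∑ fs (λ w → leqB w w′ ⊙ mono (f x) w) ∎) b∈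

  Mono-non-image : ∀ {x} → x ∈ es → (∀ {w} → w ∈ fs → x ≢ g w) → EqLC eqB (linMap f (MonoA x)) []
  Mono-non-image {x} x∈ x∉im b = trans (coeff-image x b) image≡0
    where
      image≡0 : image x b ≡ 0ℚ
      image≡0 with _∈?_ _≟B_ b fs
      ... | no b∉ = image-outside x b∉
      ... | yes b∈ = MB.∑-≤-injective (image x) (λ _ → 0ℚ) (λ {w′} w′∈ →
        trans (∑-image-mu x∈ w′∈)
          (trans (cong (_⊙ 1ℚ) (MA.≢⇒eq-false (x∉im w′∈)))
                 (sym (∑-zero fs λ {w} _ → ⊙-zero (leqB w w′))))) b∈
        where
          ⊙-zero : ∀ b → b ⊙ 0ℚ ≡ 0ℚ
          ⊙-zero true = refl
          ⊙-zero false = refl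

-- Boolean tests and membership in lists

≡true⇒T : ∀ {b} → b ≡ true → T b
≡true⇒T = Equivalence.from 𝔹ₚ.T-≡

T⇒≡true : ∀ {b} → T b → b ≡ true
T⇒≡true = Equivalence.to 𝔹ₚ.T-≡

⌊⌋⇒ : ∀ {P : Set} (d : Dec P) → ⌊ d ⌋ ≡ true → P
⌊⌋⇒ (yes p) _ = p

⇒⌊⌋ : ∀ {P : Set} (d : Dec P) → P → ⌊ d ⌋ ≡ true
⇒⌊⌋ (yes _) _ = refl
⇒⌊⌋ (no ¬p) p = contradiction p ¬p

module _ {A : Set} where

  allB⁺ : ∀ p (xs : List A) → (∀ {x} → x ∈ xs → p x ≡ true) → allB p xs ≡ true
  allB⁺ p [] h = refl
  allB⁺ p (x ∷ xs) h = ∧-true (h (here refl)) (allB⁺ p xs (h ∘ there))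

  allB⁻ : ∀ p (xs : List A) → allB p xs ≡ true → ∀ {x} → x ∈ xs → p x ≡ true
  allB⁻ p (x ∷ xs) h (here refl) = proj₁ (∧-true⁻ (p x) h)
  allB⁻ p (x ∷ xs) h (there x∈) = allB⁻ p xs (proj₂ (∧-true⁻ (p x) h)) x∈

  anyB⁺ : ∀ p {xs : List A} {x} → x ∈ xs → p x ≡ true → anyB p xs ≡ true
  anyB⁺ p (here refl) px rewrite px = refl
  anyB⁺ p {y ∷ ys} (there x∈) px rewrite anyB⁺ p x∈ px = 𝔹ₚ.∨-zeroʳ (p y)

  anyB⁻ : ∀ p (xs : List A) → anyB p xs ≡ true → ∃ λ x → x ∈ xs × p x ≡ true
  anyB⁻ p (x ∷ xs) h with p x in e
  ... | true = x , here refl , e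
  ... | false with y , y∈ , py ← anyB⁻ p xs h = y , there y∈ , py

eqℕ⇒≡ : ∀ {m n} → eqℕ m n ≡ true → m ≡ n
eqℕ⇒≡ {m} {n} e = ℕₚ.≡ᵇ⇒≡ m n (≡true⇒T e)

eqℕ-refl : ∀ m → eqℕ m m ≡ true
eqℕ-refl m = T⇒≡true (ℕₚ.≡⇒≡ᵇ m m refl)

module _ {A B : Set} where

  concatMap-∈⁺ : ∀ (f : A → List B) {xs x y} → x ∈ xs → y ∈ f x → y ∈ concatMap f xs
  concatMap-∈⁺ f x∈ y∈ = ∈ₚ.∈-concatMap⁺ f (lose x∈ y∈)

  concatMap-∈⁻ : ∀ (f : A → List B) xs {y} → y ∈ concatMap f xs → ∃ λ x → x ∈ xs × y ∈ f x
  concatMap-∈⁻ f xs y∈ = find (∈ₚ.∈-concatMap⁻ f {xs} y∈)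

  -- `h` recovers from an entry the block that it comes from, so different blocks are disjoint. For
  -- trees it reads off the left subtree or its size, for permutations it deletes the largest
  -- letter.
  concatMap-unique : ∀ (f : A → List B) (h : B → A) {xs} → Unique xs →
                     (∀ {x} → x ∈ xs → Unique (f x)) →
                     (∀ {x y} → x ∈ xs → y ∈ f x → h y ≡ x) → Unique (concatMap f xs)
  concatMap-unique f h [] _ _ = []
  concatMap-unique f h {x ∷ xs} (x∉ ∷ u) uf hf =
    Uniqueₚ.++⁺ (uf (here refl)) (concatMap-unique f h u (uf ∘ there) (hf ∘ there))
      λ (y∈fx , y∈) → let x′ , x′∈ , y∈fx′ = concatMap-∈⁻ f xs y∈ in
        Uniqueₚ.Unique[x∷xs]⇒x∉xs (x∉ ∷ u)
          (subst (_∈ xs) (trans (sym (hf (there x′∈) y∈fx′)) (hf (here refl) y∈fx)) x′∈)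

-- The Tamari order

leftT : Tree → Tree
leftT leaf = leaf
leftT (l ∨T r) = l

treesF-size : ∀ f k {t} → t ∈ treesF f k → size t ≡ k
treesF-size f zero (here refl) = refl
treesF-size (suc f) (suc k) t∈
  with i , i∈ , t∈ ← concatMap-∈⁻ (λ i → concatMap (λ l → map (l ∨T_) (treesF f (k ∸ i))) (treesF f i))
                                 (upTo (suc k)) t∈
  with l , l∈ , t∈ ← concatMap-∈⁻ (λ l → map (l ∨T_) (treesF f (k ∸ i))) (treesF f i) t∈
  with r , r∈ , refl ← ∈ₚ.∈-map⁻ (l ∨T_) t∈
  rewrite treesF-size f i l∈ | treesF-size f (k ∸ i) r∈ =
  cong suc (ℕₚ.m+[n∸m]≡n (s≤s⁻¹ (∈ₚ.∈-upTo⁻ i∈)))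

treesF-complete : ∀ f t → size t ≤ f → t ∈ treesF f (size t)
treesF-complete f leaf _ = here refl
treesF-complete (suc f) (l ∨T r) (s≤s h) =
  concatMap-∈⁺ _ (∈ₚ.∈-upTo⁺ (s≤s (ℕₚ.m≤m+n (size l) (size r))))
    (concatMap-∈⁺ _ (treesF-complete f l (ℕₚ.≤-trans (ℕₚ.m≤m+n (size l) (size r)) h))
      (∈ₚ.∈-map⁺ (l ∨T_) (subst (λ k → r ∈ treesF f k) (sym (ℕₚ.m+n∸m≡n (size l) (size r)))
        (treesF-complete f r (ℕₚ.≤-trans (ℕₚ.m≤n+m (size r) (size l)) h)))))

treesF-unique : ∀ f k → Unique (treesF f k)
treesF-unique zero zero = [] ∷ []
treesF-unique (suc f) zero = [] ∷ []
treesF-unique zero (suc k) = []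
treesF-unique (suc f) (suc k) =
  concatMap-unique _ (size ∘ leftT) (Uniqueₚ.upTo⁺ (suc k))
    (λ {i} _ → concatMap-unique _ leftT (treesF-unique f i)
      (λ {l} _ → Uniqueₚ.map⁺ (λ { refl → refl }) (treesF-unique f (k ∸ i)))
      (λ {l} _ t∈ → leftT-map {l} {i} t∈))
    (λ {i} _ t∈ → leftT-size {i} t∈)
  where
    leftT-map : ∀ {l i t} → t ∈ map (l ∨T_) (treesF f (k ∸ i)) → leftT t ≡ l
    leftT-map {l} t∈ with _ , _ , refl ← ∈ₚ.∈-map⁻ (l ∨T_) t∈ = refl

    leftT-size : ∀ {i t} → t ∈ concatMap (λ l → map (l ∨T_) (treesF f (k ∸ i))) (treesF f i) →
                 size (leftT t) ≡ i
    leftT-size {i} t∈ with l , l∈ , t∈ ← concatMap-∈⁻ (λ l → map (l ∨T_) (treesF f (k ∸ i))) (treesF f i) t∈ =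
      trans (cong size (leftT-map {l} {i} t∈)) (treesF-size f i l∈)

∈trees⁻ : ∀ n {t} → t ∈ trees n → size t ≡ n
∈trees⁻ n = treesF-size n n

∈trees⁺ : ∀ {n t} → size t ≡ n → t ∈ trees n
∈trees⁺ {t = t} refl = treesF-complete (size t) t ℕₚ.≤-refl

∨T-monoˡ : ∀ {a a′ b} → a ≤T a′ → (a ∨T b) ≤T (a′ ∨T b)
∨T-monoˡ = gmap (_∨T _) inl

∨T-monoʳ : ∀ {a b b′} → b ≤T b′ → (a ∨T b) ≤T (a ∨T b′)
∨T-monoʳ = gmap (_ ∨T_) inr

≤T-size : ∀ {s t} → s ≤T t → size s ≡ size t
≤T-size ε = refl
≤T-size (st ◅ sts) = trans (step st) (≤T-size sts)
  where
    step : ∀ {s t} → s ⟶T t → size s ≡ size t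
    step (rot {a} {b} {c}) =
      cong suc (trans (cong suc (ℕₚ.+-assoc (size a) (size b) (size c)))
                      (sym (ℕₚ.+-suc (size a) (size b ℕ.+ size c))))
    step (inl s) = cong (λ k → suc (k ℕ.+ _)) (step s)
    step (inr {a} s) = cong (λ k → suc (size a ℕ.+ k)) (step s)

-- The sum of the sizes of the right subtrees of all nodes. The rotation `rot` raises it by
-- `suc (size c)`, so no nonempty chain of rotations returns to its start; this yields antisymmetry.
rightWeight : Tree → ℕ
rightWeight leaf = 0
rightWeight (l ∨T r) = rightWeight l ℕ.+ (size r ℕ.+ rightWeight r)

rightWeight-< : ∀ {s t} → s ⟶T t → rightWeight s < rightWeight t
rightWeight-< (rot {a} {b} {c}) = begin-strict
  (A ℕ.+ (nb ℕ.+ B)) ℕ.+ (nc ℕ.+ K)           ≡⟨ ℕₚ.+-assoc A (nb ℕ.+ B) (nc ℕ.+ K) ⟩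
  A ℕ.+ ((nb ℕ.+ B) ℕ.+ (nc ℕ.+ K))           ≡⟨ cong (A ℕ.+_) (ℕₚ.+-assoc nb B (nc ℕ.+ K)) ⟩
  A ℕ.+ (nb ℕ.+ (B ℕ.+ (nc ℕ.+ K)))           <⟨ ℕₚ.+-monoʳ-< A (ℕₚ.+-monoˡ-< _ (s≤s (ℕₚ.m≤m+n nb nc))) ⟩
  A ℕ.+ (suc (nb ℕ.+ nc) ℕ.+ (B ℕ.+ (nc ℕ.+ K))) ∎
  where
    open ℕₚ.≤-Reasoning
    A = rightWeight a
    B = rightWeight b
    K = rightWeight c
    nb = size b
    nc = size c
rightWeight-< (inl s) = ℕₚ.+-monoˡ-< _ (rightWeight-< s)
rightWeight-< (inr {a} {b} {b′} s) =
  ℕₚ.+-monoʳ-< (rightWeight a)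
    (ℕₚ.+-mono-≤-< (ℕₚ.≤-reflexive (≤T-size (s ◅ ε))) (rightWeight-< s))

rightWeight-≤ : ∀ {s t} → s ≤T t → rightWeight s ≤ rightWeight t
rightWeight-≤ ε = ℕₚ.≤-refl
rightWeight-≤ (s ◅ ss) = ℕₚ.≤-trans (ℕₚ.<⇒≤ (rightWeight-< s)) (rightWeight-≤ ss)

≤T-antisym : ∀ {s t} → s ≤T t → t ≤T s → s ≡ t
≤T-antisym ε _ = refl
≤T-antisym (s ◅ ss) t≤s =
  contradiction (ℕₚ.<-≤-trans (rightWeight-< s) (ℕₚ.≤-trans (rightWeight-≤ ss) (rightWeight-≤ t≤s)))
                (ℕₚ.<-irrefl refl)

tamari-poset : ∀ n (_≤T?_ : Decidable _≤T_) → IsFinitePoset (trees n) (λ s t → ⌊ s ≤T? t ⌋) eqT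
tamari-poset n _≤T?_ = record
  { unique  = treesF-unique n n
  ; eq-refl = λ {t} → ⇒⌊⌋ (t ≟T t) refl
  ; eq⇒≡    = λ {s} {t} → ⌊⌋⇒ (s ≟T t)
  ; reflex  = λ {t} _ → ⇒⌊⌋ (t ≤T? t) ε
  ; transit = λ {r} {s} {t} _ _ _ p q → ⇒⌊⌋ (r ≤T? t) (⌊⌋⇒ (r ≤T? s) p ◅◅ ⌊⌋⇒ (s ≤T? t) q)
  ; antisym = λ {s} {t} _ _ p q → ≤T-antisym (⌊⌋⇒ (s ≤T? t) p) (⌊⌋⇒ (t ≤T? s) q)
  }

-- Leaf flags

_≼_ : List Bool → List Bool → Set
_≼_ = Pointwise _≤𝔹_

≼-refl : ∀ {ds} → ds ≼ ds
≼-refl = Pointwise.refl b≤b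

isNode : Tree → Bool
isNode leaf = false
isNode (_ ∨T _) = true

-- The flags of leaves 1, …, n (leaf 0 is omitted).
innerFlags : Tree → List Bool
innerFlags leaf = []
innerFlags (l ∨T r) = innerFlags l ++ isNode r ∷ innerFlags r

-- Leaf 0 of a node is always a left child, so a flag passed down from above survives only if the
-- tree is a single leaf. Hence the entry `isNode r` of `innerFlags` at the start of a right
-- subtree.
leafFlags-false : ∀ t → leafFlags false t ≡ isNode t ∷ innerFlags t
leafFlags-true : ∀ t → leafFlags true t ≡ true ∷ innerFlags t
leafFlags-node : ∀ l r → leafFlags true l ++ leafFlags false r ≡ true ∷ innerFlags (l ∨T r)

leafFlags-false leaf = refl
leafFlags-false (l ∨T r) = leafFlags-node l r
leafFlags-true leaf = refl
leafFlags-true (l ∨T r) = leafFlags-node l r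
leafFlags-node l r = cong₂ _++_ (leafFlags-true l) (leafFlags-false r)

length-innerFlags : ∀ t → length (innerFlags t) ≡ size t
length-innerFlags leaf = refl
length-innerFlags (l ∨T r) = begin
  length (innerFlags l ++ isNode r ∷ innerFlags r)     ≡⟨ Listₚ.length-++ (innerFlags l) ⟩
  length (innerFlags l) ℕ.+ suc (length (innerFlags r))
    ≡⟨ cong₂ (λ a b → a ℕ.+ suc b) (length-innerFlags l) (length-innerFlags r) ⟩
  size l ℕ.+ suc (size r)                              ≡⟨ ℕₚ.+-suc (size l) (size r) ⟩
  suc (size l ℕ.+ size r)                              ∎
  where open ≡-Reasoning

-- The last leaf of a nonempty tree is a right child. Words of length n with this property encode
-- the subsets of [n-1]; the empty word serves n = 0.
data EndsFalse : List Bool → Set where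
  []   : EndsFalse []
  last : EndsFalse (false ∷ [])
  cons : ∀ {b c cs} → EndsFalse (c ∷ cs) → EndsFalse (b ∷ c ∷ cs)

endsFalse-++ : ∀ bs {c cs} → EndsFalse (c ∷ cs) → EndsFalse (bs ++ c ∷ cs)
endsFalse-++ [] e = e
endsFalse-++ (b ∷ []) e = cons e
endsFalse-++ (b ∷ b′ ∷ bs) e = cons (endsFalse-++ (b′ ∷ bs) e)

endsFalse-innerFlags : ∀ t → EndsFalse (innerFlags t)
endsFalse-innerFlags leaf = []
endsFalse-innerFlags (l ∨T r) = endsFalse-++ (innerFlags l) (tail r (endsFalse-innerFlags r))
  where
    prepend : ∀ ds {d} → 0 < length ds → EndsFalse ds → EndsFalse (d ∷ ds)
    prepend (_ ∷ _) _ e = cons e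
    tail : ∀ r → EndsFalse (innerFlags r) → EndsFalse (isNode r ∷ innerFlags r)
    tail leaf _ = last
    tail r@(_ ∨T _) e = prepend (innerFlags r) (subst (0 <_) (sym (length-innerFlags r)) z<s) e

-- The rotation `rot` affects only the first leaf of `b`, whose flag becomes `true`; it changes
-- exactly when `b` is a leaf, which turns from a right into a left child.
innerFlags-step : ∀ {s t} → s ⟶T t → innerFlags s ≼ innerFlags t
innerFlags-step (rot {a} {b} {c}) =
  subst (_≼ innerFlags (a ∨T (b ∨T c)))
        (sym (Listₚ.++-assoc (innerFlags a) (isNode b ∷ innerFlags b) (isNode c ∷ innerFlags c)))
        (Pointwise.++⁺ (≼-refl {innerFlags a}) (𝔹ₚ.≤-maximum (isNode b) ∷ ≼-refl))
innerFlags-step (inl s) = Pointwise.++⁺ (innerFlags-step s) ≼-refl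
innerFlags-step (inr {a} s) = Pointwise.++⁺ (≼-refl {innerFlags a}) (node s ∷ innerFlags-step s)
  where
    node : ∀ {s t} → s ⟶T t → isNode s ≤𝔹 isNode t
    node rot = b≤b
    node (inl _) = b≤b
    node (inr _) = b≤b

innerFlags-mono : ∀ {s t} → s ≤T t → innerFlags s ≼ innerFlags t
innerFlags-mono ε = ≼-refl
innerFlags-mono (s ◅ ss) = Pointwise.transitive 𝔹ₚ.≤-trans (innerFlags-step s) (innerFlags-mono ss)

-- Splits leaf 0 into two leaves. The new leaf 1 is a right child, so the word of flags gains a
-- leading `false`.
growLeft : Tree → Tree
growLeft leaf = leaf ∨T leaf
growLeft (l ∨T r) = growLeft l ∨T r

growLeft-mono : ∀ {s t} → s ≤T t → growLeft s ≤T growLeft t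
growLeft-mono = gmap growLeft step
  where
    step : ∀ {s t} → s ⟶T t → growLeft s ⟶T growLeft t
    step rot = rot
    step (inl s) = inl (step s)
    step (inr s) = inr s

innerFlags-growLeft : ∀ t → innerFlags (growLeft t) ≡ false ∷ innerFlags t
innerFlags-growLeft leaf = refl
innerFlags-growLeft (l ∨T r) = cong (_++ _) (innerFlags-growLeft l)

-- Deletes leaf 0.
pop : Tree → Tree
pop leaf = leaf
pop (leaf ∨T r) = r
pop ((a ∨T b) ∨T r) = pop (a ∨T b) ∨T r

-- Rotations along the left branch, from the bottom upwards, bring the node above leaf 0 to the
-- root.
≤T-pop : ∀ l r → (l ∨T r) ≤T (leaf ∨T pop (l ∨T r))
≤T-pop leaf r = ε
≤T-pop (a ∨T b) r = ∨T-monoˡ (≤T-pop a b) ◅◅ (rot ◅ ε)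

-- `d` is the flag of leaf 1. If it is `false`, leaf 1 is the sibling of leaf 0, and deleting leaf 0
-- merely undoes a split.
innerFlags-pop : ∀ l r → ∃ λ d → innerFlags (l ∨T r) ≡ d ∷ innerFlags (pop (l ∨T r))
                               × (d ≡ false → l ∨T r ≡ growLeft (pop (l ∨T r)))
innerFlags-pop leaf leaf = false , refl , λ _ → refl
innerFlags-pop leaf (_ ∨T _) = true , refl , λ ()
innerFlags-pop (a ∨T b) r with d , e , h ← innerFlags-pop a b =
  d , cong (_++ isNode r ∷ innerFlags r) e , λ d≡ → cong (_∨T r) (h d≡)

-- The Tamari-largest tree with the given flags on leaves 1, …, n.
maxTree : List Bool → Tree
maxTree [] = leaf
maxTree (true ∷ ds) = leaf ∨T maxTree ds
maxTree (false ∷ ds) = growLeft (maxTree ds)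

size-growLeft : ∀ t → size (growLeft t) ≡ suc (size t)
size-growLeft leaf = refl
size-growLeft (l ∨T r) = cong (λ k → suc (k ℕ.+ size r)) (size-growLeft l)

size-maxTree : ∀ ds → size (maxTree ds) ≡ length ds
size-maxTree [] = refl
size-maxTree (true ∷ ds) = cong suc (size-maxTree ds)
size-maxTree (false ∷ ds) = trans (size-growLeft (maxTree ds)) (cong suc (size-maxTree ds))

innerFlags-maxTree : ∀ {ds} → EndsFalse ds → innerFlags (maxTree ds) ≡ ds
innerFlags-maxTree [] = refl
innerFlags-maxTree last = refl
innerFlags-maxTree {false ∷ ds} (cons e) =
  trans (innerFlags-growLeft (maxTree ds)) (cong (false ∷_) (innerFlags-maxTree e))
innerFlags-maxTree {true ∷ ds} (cons e) =
  cong₂ _∷_ (node (maxTree ds) (size-maxTree ds)) (innerFlags-maxTree e)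
  where
    node : ∀ t {k} → size t ≡ suc k → isNode t ≡ true
    node (_ ∨T _) _ = refl

-- Induction on the word by removing leaf 0. A leading `true` permits rotating leaf 0 up to the
-- root; a leading `false` forces the flag of leaf 1 to be `false`, so the tree arises by
-- `growLeft`, which is monotone.
≤T-maxTree : ∀ ds t → innerFlags t ≼ ds → t ≤T maxTree ds
≤T-maxTree [] leaf _ = ε
≤T-maxTree (_ ∷ _) leaf ()
≤T-maxTree ds (l ∨T r) p with d , e , h ← innerFlags-pop l r = go ds (subst (_≼ ds) e p)
  where
    go : ∀ ds → (d ∷ innerFlags (pop (l ∨T r))) ≼ ds → (l ∨T r) ≤T maxTree ds
    go (true ∷ ds) (_ ∷ p) = ≤T-pop l r ◅◅ ∨T-monoʳ (≤T-maxTree ds _ p)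
    go (false ∷ ds) (b≤b ∷ p) =
      subst (_≤T maxTree (false ∷ ds)) (sym (h refl)) (growLeft-mono (≤T-maxTree ds _ p))

-- Subsets of [n-1]

-- The first letter has position k.
positions : ℕ → List Bool → List ℕ
positions k [] = []
positions k (true ∷ ds) = k ∷ positions (suc k) ds
positions k (false ∷ ds) = positions (suc k) ds

positions-≥ : ∀ k ds {x} → x ∈ positions k ds → k ≤ x
positions-≥ k (true ∷ ds) (here refl) = ℕₚ.≤-refl
positions-≥ k (true ∷ ds) (there x∈) = ℕₚ.<⇒≤ (positions-≥ (suc k) ds x∈)
positions-≥ k (false ∷ ds) x∈ = ℕₚ.<⇒≤ (positions-≥ (suc k) ds x∈)

≼⇒positions-⊆ : ∀ k {ds es} → ds ≼ es → ∀ {x} → x ∈ positions k ds → x ∈ positions k es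
≼⇒positions-⊆ k (f≤t ∷ p) x∈ = there (≼⇒positions-⊆ (suc k) p x∈)
≼⇒positions-⊆ k {true ∷ _} (b≤b ∷ p) (here refl) = here refl
≼⇒positions-⊆ k {true ∷ _} (b≤b ∷ p) (there x∈) = there (≼⇒positions-⊆ (suc k) p x∈)
≼⇒positions-⊆ k {false ∷ _} (b≤b ∷ p) x∈ = ≼⇒positions-⊆ (suc k) p x∈

positions-⊆⇒≼ : ∀ k ds es → length ds ≡ length es →
                (∀ {x} → x ∈ positions k ds → x ∈ positions k es) → ds ≼ es
positions-⊆⇒≼ k [] [] _ h = []
positions-⊆⇒≼ k (d ∷ ds) (e ∷ es) len h =
  head d e h ∷ positions-⊆⇒≼ (suc k) ds es (ℕₚ.suc-injective len) (tail d e h)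
  where
    head : ∀ d e → (∀ {x} → x ∈ positions k (d ∷ ds) → x ∈ positions k (e ∷ es)) → d ≤𝔹 e
    head false e h = 𝔹ₚ.≤-minimum e
    head true true h = b≤b
    head true false h = contradiction (positions-≥ (suc k) es (h (here refl))) (ℕₚ.<-irrefl refl)

    later : ∀ e {x} → suc k ≤ x → x ∈ positions k (e ∷ es) → x ∈ positions (suc k) es
    later true k<x (here refl) = contradiction k<x (ℕₚ.<-irrefl refl)
    later true k<x (there x∈) = x∈
    later false k<x x∈ = x∈

    tail : ∀ d e → (∀ {x} → x ∈ positions k (d ∷ ds) → x ∈ positions k (e ∷ es)) →
           ∀ {x} → x ∈ positions (suc k) ds → x ∈ positions (suc k) es
    tail true e h x∈ = later e (positions-≥ (suc k) ds x∈) (h (there x∈))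
    tail false e h x∈ = later e (positions-≥ (suc k) ds x∈) (h x∈)

range : ℕ → ℕ → List ℕ
range k zero = []
range k (suc m) = k ∷ range (suc k) m

applyUpTo≡range : ∀ f k m → (∀ i → f i ≡ k ℕ.+ i) → applyUpTo f m ≡ range k m
applyUpTo≡range f k zero h = refl
applyUpTo≡range f k (suc m) h =
  cong₂ _∷_ (trans (h 0) (ℕₚ.+-identityʳ k))
            (applyUpTo≡range (f ∘ suc) (suc k) m (λ i → trans (h (suc i)) (ℕₚ.+-suc k i)))

oneTo≡range : ∀ m → oneTo m ≡ range 1 m
oneTo≡range m = trans (Listₚ.map-upTo suc m) (applyUpTo≡range suc 1 m (λ _ → refl))

positions∈sublists : ∀ k {ds} → EndsFalse ds → positions k ds ∈ sublists (range k (length ds ∸ 1))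
positions∈sublists k [] = here refl
positions∈sublists k last = here refl
positions∈sublists k {true ∷ ds} (cons e) =
  ∈ₚ.∈-++⁺ˡ (∈ₚ.∈-map⁺ (k ∷_) (positions∈sublists (suc k) e))
positions∈sublists k {false ∷ ds} (cons e) =
  ∈ₚ.∈-++⁺ʳ (map (k ∷_) (sublists (range (suc k) (length ds ∸ 1)))) (positions∈sublists (suc k) e)

sublists⇒positions : ∀ k m {S} → S ∈ sublists (range k m) →
                     ∃ λ d → ∃ λ ds → EndsFalse (d ∷ ds) × length ds ≡ m × S ≡ positions k (d ∷ ds)
sublists⇒positions k zero (here refl) = false , [] , last , refl , refl
sublists⇒positions k (suc m) S∈ with ∈ₚ.∈-++⁻ (map (k ∷_) (sublists (range (suc k) m))) S∈
... | inj₁ S∈ with _ , S′∈ , refl ← ∈ₚ.∈-map⁻ (k ∷_) S∈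
              with d , ds , e , refl , refl ← sublists⇒positions (suc k) m S′∈ =
  true , d ∷ ds , cons e , refl , refl
... | inj₂ S∈ with d , ds , e , refl , refl ← sublists⇒positions (suc k) m S∈ =
  false , d ∷ ds , cons e , refl , refl

sublists-range-≥ : ∀ k m {S x} → S ∈ sublists (range k m) → x ∈ S → k ≤ x
sublists-range-≥ k zero (here refl) ()
sublists-range-≥ k (suc m) S∈ x∈ with ∈ₚ.∈-++⁻ (map (k ∷_) (sublists (range (suc k) m))) S∈
... | inj₂ S∈ = ℕₚ.<⇒≤ (sublists-range-≥ (suc k) m S∈ x∈)
... | inj₁ S∈ with _ , S′∈ , refl ← ∈ₚ.∈-map⁻ (k ∷_) S∈ with x∈
...   | here refl = ℕₚ.≤-refl
...   | there x∈ = ℕₚ.<⇒≤ (sublists-range-≥ (suc k) m S′∈ x∈)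

sublists-unique : ∀ k m → Unique (sublists (range k m))
sublists-unique k zero = [] ∷ []
sublists-unique k (suc m) =
  Uniqueₚ.++⁺ (Uniqueₚ.map⁺ Listₚ.∷-injectiveʳ (sublists-unique (suc k) m)) (sublists-unique (suc k) m)
    λ (S∈₁ , S∈₂) → ℕₚ.<-irrefl refl (sublists-range-≥ (suc k) m S∈₂ (∈ₚ.∈-map∷⁻ S∈₁))

record Subset (n : ℕ) (S : List ℕ) : Set where
  constructor subset
  field
    flags      : List Bool
    ends       : EndsFalse flags
    len        : length flags ≡ n
    positions≡ : S ≡ positions 1 flags

∈subsetsQ⁻ : ∀ n {S} → S ∈ subsetsQ n → Subset n S
∈subsetsQ⁻ zero (here refl) = subset [] [] refl refl
∈subsetsQ⁻ (suc m) S∈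
  with d , ds , e , l , eq ← sublists⇒positions 1 m (subst (λ r → _ ∈ sublists r) (oneTo≡range m) S∈) =
  subset (d ∷ ds) e (cong suc l) eq

∈subsetsQ⁺ : ∀ {n S} → Subset n S → S ∈ subsetsQ n
∈subsetsQ⁺ (subset ds e refl refl) =
  subst (λ r → positions 1 ds ∈ sublists r) (sym (oneTo≡range (length ds ∸ 1))) (positions∈sublists 1 e)

subsetLeq⁻ : ∀ S T → subsetLeq S T ≡ true → ∀ {x} → x ∈ S → x ∈ T
subsetLeq⁻ S T h {x} x∈
  with y , y∈ , e ← anyB⁻ (eqℕ x) T (allB⁻ (λ x → anyB (eqℕ x) T) S h x∈)
  with refl ← eqℕ⇒≡ {x} {y} e = y∈

subsetLeq⁺ : ∀ S T → (∀ {x} → x ∈ S → x ∈ T) → subsetLeq S T ≡ true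
subsetLeq⁺ S T h = allB⁺ _ S (λ {x} x∈ → anyB⁺ (eqℕ x) (h x∈) (eqℕ-refl x))

eqList-refl : ∀ {u} → eqList u u ≡ true
eqList-refl {u} = ⇒⌊⌋ (Listₚ.≡-dec ℕₚ._≟_ u u) refl

eqList⇒≡ : ∀ {u v} → eqList u v ≡ true → u ≡ v
eqList⇒≡ {u} {v} = ⌊⌋⇒ (Listₚ.≡-dec ℕₚ._≟_ u v)

boolean-poset : ∀ n → IsFinitePoset (subsetsQ n) subsetLeq eqList
boolean-poset n = record
  { unique  = subst (Unique ∘ sublists) (sym (oneTo≡range (n ∸ 1))) (sublists-unique 1 (n ∸ 1))
  ; eq-refl = eqList-refl
  ; eq⇒≡    = eqList⇒≡
  ; reflex  = λ {S} _ → subsetLeq⁺ S S id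
  ; transit = λ {R} {S} {T} _ _ _ p q → subsetLeq⁺ R T (subsetLeq⁻ S T q ∘ subsetLeq⁻ R S p)
  ; antisym = antisym
  }
  where
    antisym : ∀ {S T} → S ∈ subsetsQ n → T ∈ subsetsQ n →
              subsetLeq S T ≡ true → subsetLeq T S ≡ true → S ≡ T
    antisym S∈ T∈ p q
      with subset ds _ ld refl ← ∈subsetsQ⁻ n S∈ | subset es _ le refl ← ∈subsetsQ⁻ n T∈ =
      cong (positions 1) (Pointwise.Pointwise-≡⇒≡
        (Pointwise.antisymmetric 𝔹ₚ.≤-antisym
          (positions-⊆⇒≼ 1 ds es (trans ld (sym le)) (subsetLeq⁻ (positions 1 ds) (positions 1 es) p))
          (positions-⊆⇒≼ 1 es ds (trans le (sym ld)) (subsetLeq⁻ (positions 1 es) (positions 1 ds) q))))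

-- The lower bound in `Lset` drops leaf 0 by computation. Among the later leaves the upper bound
-- excludes only the last, whose flag is `false` anyway.
Lset-positions : ∀ t → Lset t ≡ positions 1 (innerFlags t)
Lset-positions t rewrite leafFlags-false t | applyUpTo≡range suc 1 (size t) (λ _ → refl) =
  subst (λ m → map proj₁ (filterB flag (zip (range 1 m) (innerFlags t))) ≡ positions 1 (innerFlags t))
        (length-innerFlags t)
        (go 0 (endsFalse-innerFlags t) (cong suc (length-innerFlags t)))
  where
    flag : ℕ × Bool → Bool
    flag p = (0 <ᵇ proj₁ p) ∧ (proj₁ p <ᵇ size t) ∧ proj₂ p

    flag-false : ∀ k → flag (k , false) ≡ false
    flag-false k rewrite 𝔹ₚ.∧-zeroʳ (k <ᵇ size t) = 𝔹ₚ.∧-zeroʳ (0 <ᵇ k)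

    flag-true : ∀ {k} → suc k < size t → flag (suc k , true) ≡ true
    flag-true k< = ∧-true (T⇒≡true (ℕₚ.<⇒<ᵇ k<)) refl

    go : ∀ k {ds} → EndsFalse ds → suc k ℕ.+ length ds ≡ suc (size t) →
         map proj₁ (filterB flag (zip (range (suc k) (length ds)) ds)) ≡ positions (suc k) ds
    go k [] _ = refl
    go k last _ rewrite flag-false (suc k) = refl
    go k {false ∷ ds} (cons e) len rewrite flag-false (suc k) =
      go (suc k) e (trans (sym (ℕₚ.+-suc (suc k) (length ds))) len)
    go k {true ∷ ds@(_ ∷ ds′)} (cons e) len
      rewrite flag-true {k} (subst (suc k <_) (ℕₚ.suc-injective len)
                (subst (_≤ k ℕ.+ suc (suc (length ds′))) (ℕₚ.+-comm k 2)
                       (ℕₚ.+-monoʳ-≤ k (s≤s (s≤s z≤n))))) =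
      cong (suc k ∷_) (go (suc k) e (trans (sym (ℕₚ.+-suc (suc k) (length ds))) len))

-- The trees C(S) as largest trees with given leaf flags

mutual
  -- The function go local to C, recovered by unification: C-go-spec determines the placeholder.
  C-go : ℕ → List ℕ → ℕ → List ℕ → Tree
  C-go = _

  C-go-spec : ∀ n p ps → C n (p ∷ ps) ≡ comb p under C-go n (p ∷ ps) p ps
  -- Abstracting the list makes the arguments of `C-go` distinct variables, so unification has a
  -- unique solution.
  C-go-spec n p ps with p ∷ ps
  ... | S = refl

growLefts : ℕ → Tree → Tree
growLefts zero t = t
growLefts (suc j) t = growLefts j (growLeft t)

growLefts-∨T : ∀ j l r → growLefts j (l ∨T r) ≡ growLefts j l ∨T r
growLefts-∨T zero l r = refl
growLefts-∨T (suc j) l r = growLefts-∨T j (growLeft l) r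

comb≡growLefts : ∀ j → comb j ≡ growLefts j leaf
comb≡growLefts zero = refl
comb≡growLefts (suc j) = trans (cong (_∨T leaf) (comb≡growLefts j)) (sym (growLefts-∨T j leaf leaf))

-- `j` counts the `false` flags read since the last element `prev`. A `true` closes the run with
-- `comb (suc j)`; putting `t` under it gives `comb j ∨T t`, which is `growLefts j` of `leaf ∨T t`.
C-go-positions : ∀ S ds prev j →
                 C-go (prev ℕ.+ j ℕ.+ length ds) S prev (positions (suc (prev ℕ.+ j)) ds)
                 ≡ growLefts j (maxTree ds)
C-go-positions S [] prev j =
  trans (cong comb (trans (cong (_∸ prev) (ℕₚ.+-identityʳ (prev ℕ.+ j))) (ℕₚ.m+n∸m≡n prev j)))
        (comb≡growLefts j)
C-go-positions S (false ∷ ds) prev j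
  with eq ← C-go-positions S ds prev (suc j)
  rewrite ℕₚ.+-suc prev j | ℕₚ.+-suc (prev ℕ.+ j) (length ds) = eq
C-go-positions S (true ∷ ds) prev j
  with eq ← C-go-positions S ds (suc (prev ℕ.+ j)) 0
  rewrite ℕₚ.+-identityʳ (prev ℕ.+ j) | ℕₚ.+-suc (prev ℕ.+ j) (length ds)
        | sym (ℕₚ.+-suc prev j) | ℕₚ.m+n∸m≡n prev (suc j) | eq | comb≡growLefts j =
  sym (growLefts-∨T j leaf (maxTree ds))

C-positions : ∀ ds → C (length ds) (positions 1 ds) ≡ maxTree ds
C-positions ds = C-go-positions (positions 1 ds) ds 0 0

Lset-C : ∀ n {S} → S ∈ subsetsQ n → Lset (C n S) ≡ S
Lset-C n S∈ with subset ds e refl refl ← ∈subsetsQ⁻ n S∈ = begin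
  Lset (C (length ds) (positions 1 ds)) ≡⟨ cong Lset (C-positions ds) ⟩
  Lset (maxTree ds)                     ≡⟨ Lset-positions (maxTree ds) ⟩
  positions 1 (innerFlags (maxTree ds)) ≡⟨ cong (positions 1) (innerFlags-maxTree e) ⟩
  positions 1 ds                        ∎
  where open ≡-Reasoning

size-C : ∀ n {S} → S ∈ subsetsQ n → size (C n S) ≡ n
size-C n S∈ with subset ds e refl refl ← ∈subsetsQ⁻ n S∈ = trans (cong size (C-positions ds)) (size-maxTree ds)

Lset∈subsetsQ : ∀ t → Lset t ∈ subsetsQ (size t)
Lset∈subsetsQ t =
  ∈subsetsQ⁺ (subset (innerFlags t) (endsFalse-innerFlags t) (length-innerFlags t) (Lset-positions t))

Lset⊆⇒≤T-C : ∀ t {S} → S ∈ subsetsQ (size t) → subsetLeq (Lset t) S ≡ true → t ≤T C (size t) S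
Lset⊆⇒≤T-C t S∈ h with subset ds _ l refl ← ∈subsetsQ⁻ (size t) S∈ =
  subst (t ≤T_) (trans (sym (C-positions ds)) (cong (λ n → C n (positions 1 ds)) l))
    (≤T-maxTree ds t (positions-⊆⇒≼ 1 (innerFlags t) ds (trans (length-innerFlags t) (sym l))
      (subsetLeq⁻ (positions 1 (innerFlags t)) (positions 1 ds)
        (subst (λ S → subsetLeq S (positions 1 ds) ≡ true) (Lset-positions t) h))))

≤T⇒Lset⊆ : ∀ {s t} → s ≤T t → subsetLeq (Lset s) (Lset t) ≡ true
≤T⇒Lset⊆ {s} {t} s≤t rewrite Lset-positions s | Lset-positions t =
  subsetLeq⁺ (positions 1 (innerFlags s)) (positions 1 (innerFlags t)) (≼⇒positions-⊆ 1 (innerFlags-mono s≤t))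

Lset∈ : ∀ n {t} → t ∈ trees n → Lset t ∈ subsetsQ n
Lset∈ n {t} t∈ = subst (λ m → Lset t ∈ subsetsQ m) (∈trees⁻ n t∈) (Lset∈subsetsQ t)

C∈ : ∀ n {S} → S ∈ subsetsQ n → C n S ∈ trees n
C∈ n = ∈trees⁺ ∘ size-C n

Lset-C-adjoint : ∀ n (_≤T?_ : Decidable _≤T_) {t S} → t ∈ trees n → S ∈ subsetsQ n →
                 subsetLeq (Lset t) S ≡ ⌊ t ≤T? C n S ⌋
Lset-C-adjoint n _≤T?_ {t} {S} t∈ S∈ = bool-ext
  (λ h → ⇒⌊⌋ (t ≤T? C n S) (subst (λ m → t ≤T C m S) (∈trees⁻ n t∈)
           (Lset⊆⇒≤T-C t (subst (λ m → S ∈ subsetsQ m) (sym (∈trees⁻ n t∈)) S∈) h)))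
  (λ h → subst (λ T → subsetLeq (Lset t) T ≡ true) (Lset-C n S∈) (≤T⇒Lset⊆ (⌊⌋⇒ (t ≤T? C n S) h)))

module 𝓛-Galois (n : ℕ) (_≤T?_ : Decidable _≤T_) =
  Galois (tamari-poset n _≤T?_) (boolean-poset n) Lset (C n)
    (Lset∈ n) (C∈ n) (Lset-C-adjoint n _≤T?_) (Lset-C n)

-- Words compatible with a tree

-- The graph of λ on words with distinct letters.
data LamGraph : List ℕ → Tree → Set where
  leaf : LamGraph [] leaf
  node : ∀ {u m v l r} → All (_< m) u → All (_< m) v → LamGraph u l → LamGraph v r →
         LamGraph (u ++ m ∷ v) (l ∨T r)

-- The letters of w, placed in-order on the nodes of t, increase from every left subtree to its root.
data Compatible : List ℕ → Tree → Set where
  leaf : Compatible [] leaf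
  node : ∀ {u m v l r} → All (_< m) u → Compatible u l → Compatible v r →
         Compatible (u ++ m ∷ v) (l ∨T r)

LamGraph⇒Compatible : ∀ {w t} → LamGraph w t → Compatible w t
LamGraph⇒Compatible leaf = leaf
LamGraph⇒Compatible (node u< _ gl gr) = node u< (LamGraph⇒Compatible gl) (LamGraph⇒Compatible gr)

LamGraph-size : ∀ {w t} → LamGraph w t → size t ≡ length w
LamGraph-size leaf = refl
LamGraph-size (node {u} {m} {v} _ _ gl gr) =
  trans (cong suc (cong₂ ℕ._+_ (LamGraph-size gl) (LamGraph-size gr)))
        (trans (sym (ℕₚ.+-suc (length u) (length v))) (sym (Listₚ.length-++ u)))

-- A rotation keeps the in-order word and only drops conditions: the letters on `a` and the letter
-- `m′` no longer have to lie below `m`.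
Compatible-≤T : ∀ {w s t} → s ≤T t → Compatible w s → Compatible w t
Compatible-≤T ε c = c
Compatible-≤T (s ◅ ss) c = Compatible-≤T ss (step s c)
  where
    step : ∀ {w s t} → s ⟶T t → Compatible w s → Compatible w t
    step rot (node {m = m} {v = v} w< (node {u = u} {m = m′} {v = v′} u< cu cv′) cv) =
      subst (λ w → Compatible w _) (sym (Listₚ.++-assoc u (m′ ∷ v′) (m ∷ v)))
        (node u< cu (node (All.tail (Allₚ.++⁻ʳ u w<)) cv′ cv))
    step (inl s) (node u< cl cr) = node u< (step s cl) cr
    step (inr s) (node u< cl cr) = node u< cl (step s cr)

data SplitView (u : List ℕ) (m : ℕ) (v u′ : List ℕ) (m′ : ℕ) (v′ : List ℕ) : Set where
  same   : u ≡ u′ → m ≡ m′ → v ≡ v′ → SplitView u m v u′ m′ v′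
  before : ∀ x → u′ ≡ u ++ m ∷ x → v ≡ x ++ m′ ∷ v′ → SplitView u m v u′ m′ v′
  after  : ∀ x → u ≡ u′ ++ m′ ∷ x → v′ ≡ x ++ m ∷ v → SplitView u m v u′ m′ v′

splitView : ∀ u {m v} u′ {m′ v′} → u ++ m ∷ v ≡ u′ ++ m′ ∷ v′ → SplitView u m v u′ m′ v′
splitView [] [] refl = same refl refl refl
splitView [] (a ∷ u′) refl = before u′ refl refl
splitView (a ∷ u) [] refl = after u refl refl
splitView (a ∷ u) (b ∷ u′) eq with refl , eq′ ← Listₚ.∷-injective eq with splitView u u′ eq′
... | same refl refl refl = same refl refl refl
... | before x refl refl = before x refl refl
... | after x refl refl = after x refl refl

-- The largest letter cannot sit in a left subtree, so its node is on the right branch from the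
-- root. Inverse rotations along that branch lift it to the root and give a smaller tree, whose
-- subtrees are compatible with the two parts of the word.
Compatible-split : ∀ {w t} u {m v} → Compatible w t → w ≡ u ++ m ∷ v → All (_< m) u → All (_< m) v →
                   ∃ λ l → ∃ λ r → Compatible u l × Compatible v r × (l ∨T r) ≤T t
Compatible-split [] leaf ()
Compatible-split (_ ∷ _) leaf ()
Compatible-split u (node {u = y} y< cl cr) eq u< v< with splitView y u eq
... | same refl refl refl = _ , _ , cl , cr , ε
... | after x refl refl =
  contradiction (All.head (Allₚ.++⁻ʳ u y<)) (ℕₚ.<-asym (All.head (Allₚ.++⁻ʳ x v<)))
... | before x refl refl
  with l , r , cx , cv , le ← Compatible-split x cr refl (All.tail (Allₚ.++⁻ʳ y u<)) v< =
  _ , r , node y< cl cx , cv , rot ◅ ∨T-monoʳ le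

Compatible-[] : ∀ {w t} → Compatible w t → w ≡ [] → t ≡ leaf
Compatible-[] leaf _ = refl
Compatible-[] (node {u = []} _ _ _) ()
Compatible-[] (node {u = _ ∷ _} _ _ _) ()

LamGraph-≤T : ∀ {w s t} → LamGraph w s → Compatible w t → s ≤T t
LamGraph-≤T leaf c with refl ← Compatible-[] c refl = ε
LamGraph-≤T (node {u = u} u< v< gl gr) c
  with l , r , cl , cr , le ← Compatible-split u c refl u< v< =
  ∨T-monoˡ (LamGraph-≤T gl cl) ◅◅ ∨T-monoʳ (LamGraph-≤T gr cr) ◅◅ le

LamGraph-functional : ∀ {w s t} → LamGraph w s → LamGraph w t → s ≡ t
LamGraph-functional g h =
  ≤T-antisym (LamGraph-≤T g (LamGraph⇒Compatible h)) (LamGraph-≤T h (LamGraph⇒Compatible g))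

-- Weak order on words of the same length

infix 4 _⊑_

-- Inclusion of inversion sets, organized by the first position of an inversion. The recursion on
-- words makes it compatible with splitting at the root letter and with shifting the values of a
-- block.
data _⊑_ : List ℕ → List ℕ → Set where
  []  : [] ⊑ []
  _∷_ : ∀ {a b u v} → Pointwise (λ x y → x < a → y < b) u v → u ⊑ v → (a ∷ u) ⊑ (b ∷ v)

⊑-length : ∀ {u v} → u ⊑ v → length u ≡ length v
⊑-length [] = refl
⊑-length (_ ∷ p) = cong suc (⊑-length p)

module _ {R : ℕ → ℕ → Set} where

  pointwise-const : ∀ {Q : ℕ → Set} {u v} → length u ≡ length v →
                    (∀ {x y} → Q y → R x y) → All Q v → Pointwise R u v
  pointwise-const {u = []} _ h [] = []
  pointwise-const {u = _ ∷ _} len h (q ∷ qs) = h q ∷ pointwise-const (ℕₚ.suc-injective len) h qs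

  pointwise-split : ∀ {u m v u′ m′ v′} → length u ≡ length u′ →
                    Pointwise R (u ++ m ∷ v) (u′ ++ m′ ∷ v′) → Pointwise R u u′ × R m m′
  pointwise-split {[]} {u′ = []} _ (r ∷ _) = [] , r
  pointwise-split {_ ∷ _} {u′ = _ ∷ _} len (r ∷ rs)
    with rs′ , r′ ← pointwise-split (ℕₚ.suc-injective len) rs = r ∷ rs′ , r′

  pointwise-mapʳ⁺ : ∀ (f : ℕ → ℕ) {u v} → Pointwise (λ x y → R x (f y)) u v → Pointwise R u (map f v)
  pointwise-mapʳ⁺ f [] = []
  pointwise-mapʳ⁺ f (r ∷ rs) = r ∷ pointwise-mapʳ⁺ f rs

  pointwise-mapʳ⁻ : ∀ (f : ℕ → ℕ) {u} v → Pointwise R u (map f v) → Pointwise (λ x y → R x (f y)) u v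
  pointwise-mapʳ⁻ f [] [] = []
  pointwise-mapʳ⁻ f (_ ∷ v) (r ∷ rs) = r ∷ pointwise-mapʳ⁻ f v rs

  pointwise-mapˡ⁺ : ∀ (f : ℕ → ℕ) {u v} → Pointwise (λ x y → R (f x) y) u v → Pointwise R (map f u) v
  pointwise-mapˡ⁺ f [] = []
  pointwise-mapˡ⁺ f (r ∷ rs) = r ∷ pointwise-mapˡ⁺ f rs

⊑-shiftʳ⁺ : ∀ q {u v} → u ⊑ v → u ⊑ map (q ℕ.+_) v
⊑-shiftʳ⁺ q [] = []
⊑-shiftʳ⁺ q (h ∷ p) =
  pointwise-mapʳ⁺ (q ℕ.+_) (Pointwise.map (λ f x<a → ℕₚ.+-monoʳ-< q (f x<a)) h) ∷ ⊑-shiftʳ⁺ q p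

⊑-shiftʳ⁻ : ∀ q {u} v → u ⊑ map (q ℕ.+_) v → u ⊑ v
⊑-shiftʳ⁻ q [] [] = []
⊑-shiftʳ⁻ q (_ ∷ v) (h ∷ p) =
  Pointwise.map (λ f x<a → ℕₚ.+-cancelˡ-< q _ _ (f x<a)) (pointwise-mapʳ⁻ (q ℕ.+_) v h)
  ∷ ⊑-shiftʳ⁻ q v p

⊑-shiftˡ⁺ : ∀ q {u v} → u ⊑ v → map (q ℕ.+_) u ⊑ v
⊑-shiftˡ⁺ q [] = []
⊑-shiftˡ⁺ q (h ∷ p) =
  pointwise-mapˡ⁺ (q ℕ.+_) (Pointwise.map (λ f x<a → f (ℕₚ.+-cancelˡ-< q _ _ x<a)) h) ∷ ⊑-shiftˡ⁺ q p

-- On the right every pair that ends in the block `v′` and starts outside it is an inversion, so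
-- such pairs impose nothing. Pairs from `u` to `m` are no inversions on the left, and the pairs
-- inside a block are the hypotheses.
⊑-node : ∀ {u m v u′ m′ v′} → All (_< m) u → u ⊑ u′ → v ⊑ v′ →
         All (λ b → All (_< b) v′) u′ → All (_< m′) v′ → (u ++ m ∷ v) ⊑ (u′ ++ m′ ∷ v′)
⊑-node [] [] q [] v′< = pointwise-const (⊑-length q) (λ y< _ → y<) v′< ∷ q
⊑-node (a<m ∷ u<) (h ∷ p) q (v′<b ∷ cross) v′< =
  Pointwise.++⁺ h ((λ m<a → contradiction m<a (ℕₚ.<-asym a<m))
                   ∷ pointwise-const (⊑-length q) (λ y< _ → y<) v′<b)
  ∷ ⊑-node u< p q cross v′<

-- The pairs from `u′` to `m′` are no inversions, hence neither are the corresponding pairs of `w`;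
-- distinct letters turn this into strict inequality.
⊑-node⁻ : ∀ u′ {w m′ v′} → Unique w → w ⊑ (u′ ++ m′ ∷ v′) → All (_< m′) u′ →
          ∃ λ u → ∃ λ m → ∃ λ v → w ≡ u ++ m ∷ v × All (_< m) u × u ⊑ u′ × v ⊑ v′
⊑-node⁻ [] _ (_ ∷ p) [] = [] , _ , _ , refl , [] , [] , p
⊑-node⁻ (b ∷ u′) (a∉ ∷ uw) (h ∷ p) (b< ∷ u′<)
  with u , m , v , refl , u< , pu , pv ← ⊑-node⁻ u′ uw p u′<
  with hu , hm ← pointwise-split {u = u} (⊑-length pu) h =
  _ ∷ u , m , v , refl
  , ℕₚ.≤∧≢⇒< (ℕₚ.≮⇒≥ (λ m<a → ℕₚ.<-asym b< (hm m<a))) (All.lookup a∉ (∈ₚ.∈-insert u)) ∷ u<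
  , hu ∷ pu , pv

-- The maximal permutation with a given tree

-- σ ∨ τ of the paper, iterated over the tree.
maxPerm : Tree → List ℕ
maxPerm leaf = []
maxPerm (l ∨T r) = map (size r ℕ.+_) (maxPerm l) ++ suc (size l ℕ.+ size r) ∷ maxPerm r

+-≤-swap : ∀ q {p x} → x ≤ p → q ℕ.+ x ≤ p ℕ.+ q
+-≤-swap q {p} x≤p = ℕₚ.≤-trans (ℕₚ.+-monoʳ-≤ q x≤p) (ℕₚ.≤-reflexive (ℕₚ.+-comm q p))

Within : ℕ → ℕ → Set
Within n x = 0 < x × x ≤ n

maxPerm-within : ∀ t → All (Within (size t)) (maxPerm t)
maxPerm-within leaf = []
maxPerm-within (l ∨T r) = Allₚ.++⁺
  (Allₚ.map⁺ (All.map (λ (0<x , x≤) →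
    ℕₚ.<-≤-trans 0<x (ℕₚ.m≤n+m _ (size r)) ,
    ℕₚ.m≤n⇒m≤1+n (+-≤-swap (size r) x≤)) (maxPerm-within l)))
  ((z<s , ℕₚ.≤-refl) ∷
   All.map (λ (0<x , x≤) → 0<x , ℕₚ.m≤n⇒m≤1+n (ℕₚ.≤-trans x≤ (ℕₚ.m≤n+m (size r) (size l)))) (maxPerm-within r))

maxPerm-left< : ∀ l r → All (_< suc (size l ℕ.+ size r)) (map (size r ℕ.+_) (maxPerm l))
maxPerm-left< l r = Allₚ.map⁺ (All.map
  (λ (_ , x≤) → s≤s (+-≤-swap (size r) x≤)) (maxPerm-within l))

maxPerm-right< : ∀ l r → All (_< suc (size l ℕ.+ size r)) (maxPerm r)
maxPerm-right< l r =
  All.map (λ (_ , x≤) → s≤s (ℕₚ.≤-trans x≤ (ℕₚ.m≤n+m (size r) (size l)))) (maxPerm-within r)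

maxPerm-right<left : ∀ l r → All (λ b → All (_< b) (maxPerm r)) (map (size r ℕ.+_) (maxPerm l))
maxPerm-right<left l r = Allₚ.map⁺ (All.map
  (λ (0<x , _) → All.map (λ (_ , y≤) → ℕₚ.≤-<-trans y≤ (ℕₚ.m<m+n (size r) 0<x)) (maxPerm-within r))
  (maxPerm-within l))

Compatible⇒⊑ : ∀ {w t} → Compatible w t → w ⊑ maxPerm t
Compatible⇒⊑ leaf = []
Compatible⇒⊑ (node {l = l} {r = r} u< cl cr) =
  ⊑-node u< (⊑-shiftʳ⁺ (size r) (Compatible⇒⊑ cl)) (Compatible⇒⊑ cr)
    (maxPerm-right<left l r) (maxPerm-right< l r)

unique-++⁻ : ∀ {A : Set} (xs : List A) {ys} → Unique (xs ++ ys) →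
             Unique xs × Unique ys × (∀ {x y} → x ∈ xs → y ∈ ys → x ≢ y)
unique-++⁻ [] u = [] , u , λ ()
unique-++⁻ (x ∷ xs) (x∉ ∷ u) with uxs , uys , dis ← unique-++⁻ xs u =
  Allₚ.++⁻ˡ xs x∉ ∷ uxs , uys , λ where
    (here refl) y∈ → All.lookup (Allₚ.++⁻ʳ xs x∉) y∈
    (there x∈) y∈ → dis x∈ y∈

⊑⇒Compatible : ∀ {w} t → Unique w → w ⊑ maxPerm t → Compatible w t
⊑⇒Compatible leaf _ [] = leaf
⊑⇒Compatible (l ∨T r) uw p
  with u , m , v , refl , u< , pu , pv ← ⊑-node⁻ (map (size r ℕ.+_) (maxPerm l)) uw p (maxPerm-left< l r)
  with uu , _ ∷ uv , _ ← unique-++⁻ u uw =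
  node u< (⊑⇒Compatible l uu (⊑-shiftʳ⁻ (size r) (maxPerm l) pu)) (⊑⇒Compatible r uv pv)

LamGraph-map⁺ : ∀ {f} → (∀ {x y} → x < y → f x < f y) → ∀ {w t} → LamGraph w t → LamGraph (map f w) t
LamGraph-map⁺ mono leaf = leaf
LamGraph-map⁺ {f} mono (node {u = u} {m} {v} u< v< gl gr) =
  subst (λ w → LamGraph w _) (sym (Listₚ.map-++ f u (m ∷ v)))
    (node (Allₚ.map⁺ (All.map mono u<)) (Allₚ.map⁺ (All.map mono v<))
          (LamGraph-map⁺ mono gl) (LamGraph-map⁺ mono gr))

map-split : ∀ (f : ℕ → ℕ) w u {m v} → u ++ m ∷ v ≡ map f w →
            ∃ λ u₀ → ∃ λ m₀ → ∃ λ v₀ → w ≡ u₀ ++ m₀ ∷ v₀ × u ≡ map f u₀ × m ≡ f m₀ × v ≡ map f v₀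
map-split f (x ∷ w) [] refl = [] , x , w , refl , refl , refl , refl
map-split f (x ∷ w) (a ∷ u) eq with refl , eq′ ← Listₚ.∷-injective eq
  with u₀ , m₀ , v₀ , refl , refl , refl , refl ← map-split f w u eq′ =
  x ∷ u₀ , m₀ , v₀ , refl , refl , refl , refl
map-split f [] [] ()
map-split f [] (_ ∷ _) ()

LamGraph-map⁻ : ∀ {f} → (∀ {x y} → f x < f y → x < y) →
                ∀ {w w′ t} → w′ ≡ map f w → LamGraph w′ t → LamGraph w t
LamGraph-map⁻ reflects {[]} eq leaf = leaf
LamGraph-map⁻ {f} reflects {w} eq (node {u = u} u< v< gl gr)
  with u₀ , m₀ , v₀ , refl , refl , refl , refl ← map-split f w u eq =
  node (All.map reflects (Allₚ.map⁻ u<)) (All.map reflects (Allₚ.map⁻ v<))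
       (LamGraph-map⁻ reflects refl gl) (LamGraph-map⁻ reflects refl gr)

LamGraph-maxPerm : ∀ t → LamGraph (maxPerm t) t
LamGraph-maxPerm leaf = leaf
LamGraph-maxPerm (l ∨T r) =
  node (maxPerm-left< l r) (maxPerm-right< l r)
       (LamGraph-map⁺ (ℕₚ.+-monoʳ-< (size r)) (LamGraph-maxPerm l)) (LamGraph-maxPerm r)

-- Standardization

count< : ℕ → List ℕ → ℕ
count< x w = length (filterB (λ y → y <ᵇ x) w)

<ᵇ-true : ∀ {x y} → x < y → (x <ᵇ y) ≡ true
<ᵇ-true = T⇒≡true ∘ ℕₚ.<⇒<ᵇ

<ᵇ-true⁻ : ∀ {x y} → (x <ᵇ y) ≡ true → x < y
<ᵇ-true⁻ {x} {y} = ℕₚ.<ᵇ⇒< x y ∘ ≡true⇒T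

<ᵇ-irrefl : ∀ x → (x <ᵇ x) ≡ false
<ᵇ-irrefl zero = refl
<ᵇ-irrefl (suc x) = <ᵇ-irrefl x

count<-mono : ∀ w {x y} → x ≤ y → count< x w ≤ count< y w
count<-mono w x≤y = filterB-length-≤ w λ _ z<x → <ᵇ-true (ℕₚ.<-≤-trans (<ᵇ-true⁻ z<x) x≤y)

count<-strict : ∀ {w x y} → x ∈ w → x < y → count< x w < count< y w
count<-strict {x = x} x∈ x<y =
  filterB-length-< x∈ (<ᵇ-irrefl x) (<ᵇ-true x<y) λ _ z<x → <ᵇ-true (ℕₚ.<-trans (<ᵇ-true⁻ z<x) x<y)

count<-reflects : ∀ w {x y} → suc (count< x w) < suc (count< y w) → x < y
count<-reflects w h = ℕₚ.≰⇒> λ y≤x → ℕₚ.<⇒≱ h (s≤s (count<-mono w y≤x))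

count<-++ : ∀ x u v → count< x (u ++ v) ≡ count< x u ℕ.+ count< x v
count<-++ x [] v = refl
count<-++ x (y ∷ u) v with y <ᵇ x
... | true = cong suc (count<-++ x u v)
... | false = count<-++ x u v

count<-all : ∀ {x u} → All (_< x) u → count< x u ≡ length u
count<-all [] = refl
count<-all (y<x ∷ u<) rewrite <ᵇ-true y<x = cong suc (count<-all u<)

count<-↭ : ∀ x {u v} → u ↭ v → count< x u ≡ count< x v
count<-↭ x ↭.refl = refl
count<-↭ x (prep y p) with y <ᵇ x
... | true = cong suc (count<-↭ x p)
... | false = count<-↭ x p
count<-↭ x (swap y z p) with y <ᵇ x | z <ᵇ x
... | true | true = cong (suc ∘ suc) (count<-↭ x p)
... | true | false = cong suc (count<-↭ x p)
... | false | true = cong suc (count<-↭ x p)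
... | false | false = count<-↭ x p
count<-↭ x (↭.trans p q) = trans (count<-↭ x p) (count<-↭ x q)

map-local-cong : ∀ {f g : ℕ → ℕ} w → (∀ {x} → x ∈ w → f x ≡ g x) → map f w ≡ map g w
map-local-cong [] h = refl
map-local-cong (x ∷ w) h = cong₂ _∷_ (h (here refl)) (map-local-cong w (h ∘ there))

map-local-id : ∀ {f : ℕ → ℕ} {w x} → map f w ≡ w → x ∈ w → f x ≡ x
map-local-id eq (here refl) = Listₚ.∷-injectiveˡ eq
map-local-id eq (there x∈) = map-local-id (Listₚ.∷-injectiveʳ eq) x∈

map-local-unique : ∀ {f : ℕ → ℕ} {w} → (∀ {x y} → x ∈ w → y ∈ w → f x ≡ f y → x ≡ y) →
                   Unique w → Unique (map f w)
map-local-unique inj [] = []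
map-local-unique inj (x∉ ∷ u) =
  Allₚ.map⁺ (All.tabulate λ y∈ eq → All.lookup x∉ y∈ (inj (here refl) (there y∈) eq))
  ∷ map-local-unique (λ x∈ y∈ → inj (there x∈) (there y∈)) u

st-unique : ∀ {w} → Unique w → Unique (st w)
st-unique {w} = map-local-unique λ {x} {y} x∈ y∈ eq → case x∈ y∈ (ℕₚ.suc-injective eq) (ℕₚ.<-cmp x y)
  where
    case : ∀ {x y} → x ∈ w → y ∈ w → count< x w ≡ count< y w →
           Tri (x < y) (x ≡ y) (y < x) → x ≡ y
    case x∈ y∈ eq (tri< x<y _ _) = contradiction eq (ℕₚ.<⇒≢ (count<-strict x∈ x<y))
    case x∈ y∈ eq (tri≈ _ x≡y _) = x≡y
    case x∈ y∈ eq (tri> _ _ y<x) = contradiction (sym eq) (ℕₚ.<⇒≢ (count<-strict y∈ y<x))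

-- Replacing letters by their ranks preserves and reflects the order on `w`, so ranks computed a
-- second time are the same.
st-idem : ∀ w → st (st w) ≡ st w
st-idem w = trans (sym (Listₚ.map-∘ w)) (map-local-cong w λ x∈ → cong suc (count-st x∈ w id))
  where
    rnk : ℕ → ℕ
    rnk x = suc (count< x w)
    -- The list being counted shrinks in the induction, while `w`, which defines `rnk`, stays fixed.
    count-st : ∀ {x} → x ∈ w → ∀ v → (∀ {y} → y ∈ v → y ∈ w) → count< (rnk x) (map rnk v) ≡ count< x v
    count-st x∈ [] _ = refl
    count-st {x} x∈ (y ∷ v) v⊆w with y <ᵇ x in e | rnk y <ᵇ rnk x in e′
    ... | true | true = cong suc (count-st x∈ v (v⊆w ∘ there))
    ... | false | false = count-st x∈ v (v⊆w ∘ there)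
    ... | true | false =
      true≢false (<ᵇ-true {rnk y} (s≤s (count<-strict {w} {y} {x} (v⊆w (here refl)) (<ᵇ-true⁻ e)))) e′
    ... | false | true = true≢false (<ᵇ-true (count<-reflects w {y} {x} (<ᵇ-true⁻ {rnk y} e′))) e

maxSplit : ∀ x xs → Unique (x ∷ xs) →
           ∃ λ u → ∃ λ m → ∃ λ v → x ∷ xs ≡ u ++ m ∷ v × All (_< m) u × All (_< m) v
maxSplit x [] _ = [] , x , [] , refl , [] , []
maxSplit x (y ∷ ys) (x∉ ∷ uq) with u , m , v , eq , u< , v< ← maxSplit y ys uq with ℕₚ.<-cmp x m
... | tri< x<m _ _ = x ∷ u , m , v , cong (x ∷_) eq , x<m ∷ u< , v<
... | tri≈ _ refl _ = contradiction refl (All.lookup x∉ (subst (x ∈_) (sym eq) (∈ₚ.∈-insert u)))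
... | tri> _ _ m<x = [] , x , y ∷ ys , refl , [] ,
  subst (All (_< x)) (sym eq)
    (Allₚ.++⁺ (All.map (λ a<m → ℕₚ.<-trans a<m m<x) u<) (m<x ∷ All.map (λ a<m → ℕₚ.<-trans a<m m<x) v<))

takeWhile-≢ : ∀ {m} u v → All (_< m) u → takeWhile (λ x → ¬? (x ℕₚ.≟ m)) (u ++ m ∷ v) ≡ u
takeWhile-≢ {m} [] v [] rewrite eqℕ-refl m = refl
-- The decision `x ≟ m` computes through `≡ᵇ`, so a case split on the Boolean already reduces
-- `takeWhile`.
takeWhile-≢ {m} (x ∷ u) v (x<m ∷ u<) with x ≡ᵇ m in e
... | true = contradiction (eqℕ⇒≡ {x} e) (ℕₚ.<⇒≢ x<m)
... | false = cong (x ∷_) (takeWhile-≢ u v u<)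

drop-++ : ∀ (u : List ℕ) m v → drop (suc (length u)) (u ++ m ∷ v) ≡ v
drop-++ [] m v = refl
drop-++ (x ∷ u) m v = drop-++ u m v

lamF-node : ∀ f x xs {u v} → x ∷ xs ≡ u ++ length (x ∷ xs) ∷ v → All (_< length (x ∷ xs)) u →
            lamF (suc f) (x ∷ xs) ≡ lamF f (st u) ∨T lamF f (st v)
lamF-node f x xs {u} {v} eq u< =
  cong₂ _∨T_ (cong (lamF f ∘ st) left≡u)
             (cong (lamF f ∘ st) (trans (cong (λ y → drop (suc (length y)) (x ∷ xs)) left≡u)
                                        (trans (cong (drop (suc (length u))) eq) (drop-++ u _ v))))
  where
    n = length (x ∷ xs)
    left≡u : takeWhile (λ y → ¬? (y ℕₚ.≟ n)) (x ∷ xs) ≡ u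
    left≡u = trans (cong (takeWhile (λ y → ¬? (y ℕₚ.≟ n))) eq) (takeWhile-≢ u v u<)

-- In a standardized word the largest letter equals the length, so `lamF` cuts exactly at the
-- maximum. The recursive calls see `st u` and `st v`, which are standardized again, and since ranks
-- reflect the order their trees are also trees of `u` and `v`.
lamF-graph : ∀ f w → length w ≤ f → Unique w → st w ≡ w → LamGraph w (lamF f w)
lamF-graph zero [] _ _ _ = leaf
lamF-graph (suc f) [] _ _ _ = leaf
lamF-graph (suc f) (x ∷ xs) (s≤s len) uw std with maxSplit x xs uw
... | u , m , v , eq , u< , v< =
  subst₂ LamGraph (sym eq)
    (sym (lamF-node f x xs (trans eq (cong (λ k → u ++ k ∷ v) m≡)) (subst (λ k → All (_< k) u) m≡ u<)))
    (node u< v< (part u (ℕₚ.m≤m+n (length u) (length v)) (proj₁ uniq))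
                (part v (ℕₚ.m≤n+m (length v) (length u)) (tail-unique (proj₁ (proj₂ uniq)))))
  where
    length≡ : length (x ∷ xs) ≡ suc (length u ℕ.+ length v)
    length≡ = trans (cong length eq) (trans (Listₚ.length-++ u) (ℕₚ.+-suc (length u) (length v)))

    m≡ : m ≡ length (x ∷ xs)
    m≡ = begin
      m                               ≡⟨ sym (map-local-id std (subst (m ∈_) (sym eq) (∈ₚ.∈-insert u))) ⟩
      suc (count< m (x ∷ xs))         ≡⟨ cong (suc ∘ count< m) eq ⟩
      suc (count< m (u ++ m ∷ v))     ≡⟨ cong suc (count<-++ m u (m ∷ v)) ⟩
      suc (count< m u ℕ.+ count< m (m ∷ v))
        ≡⟨ cong₂ (λ a b → suc (a ℕ.+ b)) (count<-all u<) (trans count-m (count<-all v<)) ⟩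
      suc (length u ℕ.+ length v)     ≡⟨ sym length≡ ⟩
      length (x ∷ xs)                 ∎
      where
        open ≡-Reasoning
        count-m : count< m (m ∷ v) ≡ count< m v
        count-m rewrite <ᵇ-irrefl m = refl

    uniq = unique-++⁻ u (subst Unique eq uw)

    tail-unique : ∀ {y ys} → Unique {A = ℕ} (y ∷ ys) → Unique ys
    tail-unique (_ ∷ u) = u

    part : ∀ y → length y ≤ length u ℕ.+ length v → Unique y → LamGraph y (lamF f (st y))
    part y y≤ uy = LamGraph-map⁻ (count<-reflects y) refl
      (lamF-graph f (st y)
        (ℕₚ.≤-trans (ℕₚ.≤-reflexive (Listₚ.length-map _ y))
                    (ℕₚ.≤-trans y≤ (ℕₚ.≤-trans (ℕₚ.≤-reflexive (ℕₚ.suc-injective (sym length≡))) len)))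
        (st-unique uy) (st-idem y))

-- Permutations of [n]

∈oneTo⁻ : ∀ n {x} → x ∈ oneTo n → Within n x
∈oneTo⁻ n x∈ with _ , i∈ , refl ← ∈ₚ.∈-map⁻ suc x∈ = z<s , ∈ₚ.∈-upTo⁻ i∈

oneTo-suc : ∀ n → oneTo (suc n) ↭ suc n ∷ oneTo n
oneTo-suc n = ↭-trans
  (↭-reflexive (trans (cong (map suc) (sym (Listₚ.upTo-∷ʳ n))) (Listₚ.map-++ suc (upTo n) (n ∷ []))))
  (↭ₚ.++-comm (oneTo n) (suc n ∷ []))

oneTo-+ : ∀ q p → oneTo (q ℕ.+ p) ↭ map (q ℕ.+_) (oneTo p) ++ oneTo q
oneTo-+ q zero = ↭-reflexive (cong oneTo (ℕₚ.+-identityʳ q))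
oneTo-+ q (suc p) = begin
  oneTo (q ℕ.+ suc p)                                  ≡⟨ cong oneTo (ℕₚ.+-suc q p) ⟩
  oneTo (suc (q ℕ.+ p))                                ↭⟨ oneTo-suc (q ℕ.+ p) ⟩
  suc (q ℕ.+ p) ∷ oneTo (q ℕ.+ p)                      ≡⟨ cong (_∷ oneTo (q ℕ.+ p)) (sym (ℕₚ.+-suc q p)) ⟩
  q ℕ.+ suc p ∷ oneTo (q ℕ.+ p)                        ↭⟨ prep _ (oneTo-+ q p) ⟩
  map (q ℕ.+_) (suc p ∷ oneTo p) ++ oneTo q
    ↭⟨ ↭ₚ.++⁺ʳ (oneTo q) (↭ₚ.map⁺ (q ℕ.+_) (↭-sym (oneTo-suc p))) ⟩
  map (q ℕ.+_) (oneTo (suc p)) ++ oneTo q              ∎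
  where open ↭.PermutationReasoning

maxPerm-↭ : ∀ t → maxPerm t ↭ oneTo (size t)
maxPerm-↭ leaf = ↭-refl
maxPerm-↭ (l ∨T r) = begin
  map (size r ℕ.+_) (maxPerm l) ++ n ∷ maxPerm r          ↭⟨ ↭ₚ.shift n _ _ ⟩
  n ∷ map (size r ℕ.+_) (maxPerm l) ++ maxPerm r
    ↭⟨ prep n (↭ₚ.++⁺ (↭ₚ.map⁺ (size r ℕ.+_) (maxPerm-↭ l)) (maxPerm-↭ r)) ⟩
  n ∷ map (size r ℕ.+_) (oneTo (size l)) ++ oneTo (size r) ↭⟨ prep n (↭-sym (oneTo-+ (size r) (size l))) ⟩
  n ∷ oneTo (size r ℕ.+ size l)                           ≡⟨ cong (λ k → n ∷ oneTo k) (ℕₚ.+-comm (size r) (size l)) ⟩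
  n ∷ oneTo (size l ℕ.+ size r)                           ↭⟨ ↭-sym (oneTo-suc (size l ℕ.+ size r)) ⟩
  oneTo n                                                 ∎
  where
    open ↭.PermutationReasoning
    n = suc (size l ℕ.+ size r)

insertAll-∈⁻ : ∀ a xs {σ} → σ ∈ insertAll a xs → ∃ λ us → ∃ λ vs → xs ≡ us ++ vs × σ ≡ us ++ a ∷ vs
insertAll-∈⁻ a [] (here refl) = [] , [] , refl , refl
insertAll-∈⁻ a (x ∷ xs) (here refl) = [] , x ∷ xs , refl , refl
insertAll-∈⁻ a (x ∷ xs) (there σ∈) with τ , τ∈ , refl ← ∈ₚ.∈-map⁻ (x ∷_) σ∈
  with us , vs , refl , refl ← insertAll-∈⁻ a xs τ∈ = x ∷ us , vs , refl , refl

insertAll-∈⁺ : ∀ a us vs → us ++ a ∷ vs ∈ insertAll a (us ++ vs)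
insertAll-∈⁺ a [] [] = here refl
insertAll-∈⁺ a [] (v ∷ vs) = here refl
insertAll-∈⁺ a (u ∷ us) vs = there (∈ₚ.∈-map⁺ (u ∷_) (insertAll-∈⁺ a us vs))

insertAll-unique : ∀ a xs → a ∉ xs → Unique (insertAll a xs)
insertAll-unique a [] _ = [] ∷ []
insertAll-unique a (x ∷ xs) a∉ =
  All.tabulate (λ σ∈ eq → a∉ (head σ∈ eq))
  ∷ Uniqueₚ.map⁺ Listₚ.∷-injectiveʳ (insertAll-unique a xs (a∉ ∘ there))
  where
    head : ∀ {σ} → σ ∈ map (x ∷_) (insertAll a xs) → a ∷ x ∷ xs ≡ σ → a ∈ x ∷ xs
    head σ∈ refl with _ , _ , refl ← ∈ₚ.∈-map⁻ (x ∷_) σ∈ = here refl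

∈perms⁻ : ∀ n {σ} → σ ∈ perms n → σ ↭ oneTo n
∈perms⁻ zero (here refl) = ↭-refl
∈perms⁻ (suc n) σ∈
  with τ , τ∈ , σ∈ ← concatMap-∈⁻ (insertAll (suc n)) (perms n) σ∈
  with us , vs , refl , refl ← insertAll-∈⁻ (suc n) τ σ∈ =
  ↭-trans (↭ₚ.shift (suc n) us vs) (↭-trans (prep (suc n) (∈perms⁻ n τ∈)) (↭-sym (oneTo-suc n)))

∈perms⁺ : ∀ n {σ} → σ ↭ oneTo n → σ ∈ perms n
∈perms⁺ zero p with refl ← ↭ₚ.↭-empty-inv p = here refl
∈perms⁺ (suc n) p
  with us , vs , refl ← ∈ₚ.∈-∃++ (↭ₚ.∈-resp-↭ (↭-sym (↭-trans p (oneTo-suc n))) (here refl)) =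
  concatMap-∈⁺ (insertAll (suc n)) (∈perms⁺ n (↭ₚ.drop-mid us [] (↭-trans p (oneTo-suc n))))
               (insertAll-∈⁺ (suc n) us vs)

perms-∉ : ∀ n {τ} → τ ∈ perms n → suc n ∉ τ
perms-∉ n τ∈ h = ℕₚ.<-irrefl refl (proj₂ (∈oneTo⁻ n (↭ₚ.∈-resp-↭ (∈perms⁻ n τ∈) h)))

remove : ℕ → List ℕ → List ℕ
remove a = filterB (λ x → not (eqℕ x a))

remove-∉ : ∀ a xs → a ∉ xs → remove a xs ≡ xs
remove-∉ a [] _ = refl
remove-∉ a (x ∷ xs) a∉ with eqℕ x a in e
... | true = contradiction (here (sym (eqℕ⇒≡ {x} e))) a∉
... | false = cong (x ∷_) (remove-∉ a xs (a∉ ∘ there))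

remove-insert : ∀ a us vs → a ∉ us ++ vs → remove a (us ++ a ∷ vs) ≡ us ++ vs
remove-insert a [] vs a∉ rewrite eqℕ-refl a = remove-∉ a vs a∉
remove-insert a (u ∷ us) vs a∉ with eqℕ u a in e
... | true = contradiction (here (sym (eqℕ⇒≡ {u} e))) a∉
... | false = cong (u ∷_) (remove-insert a us vs (a∉ ∘ there))

perms-unique : ∀ n → Unique (perms n)
perms-unique zero = [] ∷ []
perms-unique (suc n) =
  concatMap-unique (insertAll (suc n)) (remove (suc n)) (perms-unique n)
    (λ {τ} τ∈ → insertAll-unique (suc n) τ (perms-∉ n τ∈)) removes
  where
    removes : ∀ {τ σ} → τ ∈ perms n → σ ∈ insertAll (suc n) τ → remove (suc n) σ ≡ τ
    removes {τ} τ∈ σ∈ with us , vs , refl , refl ← insertAll-∈⁻ (suc n) τ σ∈ =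
      remove-insert (suc n) us vs (perms-∉ n τ∈)

perm-unique : ∀ n {σ} → σ ↭ oneTo n → Unique σ
perm-unique n p = ↭ₛₚ.Unique-resp-↭ (setoid ℕ) (↭⇒↭ₛ (↭-sym p))
                    (Uniqueₚ.map⁺ ℕₚ.suc-injective (Uniqueₚ.upTo⁺ n))

perm-length : ∀ n {σ} → σ ↭ oneTo n → length σ ≡ n
perm-length n p = trans (↭ₚ.↭-length p) (trans (Listₚ.length-map suc (upTo n)) (Listₚ.length-upTo n))

count<-oneTo : ∀ n {x} → Within n x → suc (count< x (oneTo n)) ≡ x
count<-oneTo zero (0<x , x≤0) = contradiction x≤0 (ℕₚ.<⇒≱ 0<x)
count<-oneTo (suc n) {x} (0<x , x≤) with ℕₚ.m≤n⇒m<n∨m≡n x≤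
... | inj₂ refl = cong suc (begin
  count< (suc n) (oneTo (suc n))     ≡⟨ count<-↭ (suc n) (oneTo-suc n) ⟩
  count< (suc n) (suc n ∷ oneTo n)   ≡⟨ cong (λ b → length (if b then suc n ∷ xs else xs)) (<ᵇ-irrefl n) ⟩
  count< (suc n) (oneTo n)           ≡⟨ count<-all (All.tabulate λ y∈ → s≤s (proj₂ (∈oneTo⁻ n y∈))) ⟩
  length (oneTo n)                   ≡⟨ perm-length n ↭-refl ⟩
  n                                  ∎)
  where
    open ≡-Reasoning
    xs = filterB (λ y → y <ᵇ suc n) (oneTo n)
... | inj₁ (s≤s x≤n) = begin
  suc (count< x (oneTo (suc n)))     ≡⟨ cong suc (count<-↭ x (oneTo-suc n)) ⟩
  suc (count< x (suc n ∷ oneTo n))   ≡⟨ cong (λ b → suc (length (if b then suc n ∷ xs else xs))) n≮x ⟩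
  suc (count< x (oneTo n))           ≡⟨ count<-oneTo n (0<x , x≤n) ⟩
  x                                  ∎
  where
    open ≡-Reasoning
    xs = filterB (λ y → y <ᵇ x) (oneTo n)
    n≮x : (suc n <ᵇ x) ≡ false
    n≮x with suc n <ᵇ x in e
    ... | false = refl
    ... | true = contradiction (<ᵇ-true⁻ {suc n} e) (ℕₚ.≤⇒≯ x≤)

perm-st : ∀ n {σ} → σ ↭ oneTo n → st σ ≡ σ
perm-st n {σ} p = trans
  (map-local-cong σ λ {x} x∈ → trans (cong suc (count<-↭ x p))
    (count<-oneTo n (∈oneTo⁻ n (↭ₚ.∈-resp-↭ p x∈))))
  (Listₚ.map-id σ)

lam-graph : ∀ n {σ} → σ ↭ oneTo n → LamGraph σ (lam σ)
lam-graph n {σ} p = lamF-graph (length σ) σ ℕₚ.≤-refl (perm-unique n p) (perm-st n p)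

-- Inversions

data At : List ℕ → ℕ → ℕ → Set where
  here  : ∀ {x w} → At (x ∷ w) 0 x
  there : ∀ {x y w i} → At w i x → At (y ∷ w) (suc i) x

At-functional : ∀ {w i x y} → At w i x → At w i y → x ≡ y
At-functional here here = refl
At-functional (there p) (there q) = At-functional p q

record Inversion (w : List ℕ) (i j : ℕ) : Set where
  constructor inversion
  field
    {x y} : ℕ
    atᵢ   : At w i x
    atⱼ   : At w j y
    i<j   : i < j
    y<x   : y < x

-- Stated for a general `f` because the tail of `applyUpTo f` is an `applyUpTo (f ∘ suc)`; it is
-- used with the identity.
zip-∈⁻ : ∀ (f : ℕ → ℕ) w {i x} → (i , x) ∈ zip (applyUpTo f (length w)) w → ∃ λ k → i ≡ f k × At w k x
zip-∈⁻ f (a ∷ w) (here refl) = 0 , refl , here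
zip-∈⁻ f (a ∷ w) (there p) with k , eq , at ← zip-∈⁻ (f ∘ suc) w p = suc k , eq , there at

zip-∈⁺ : ∀ (f : ℕ → ℕ) {w k x} → At w k x → (f k , x) ∈ zip (applyUpTo f (length w)) w
zip-∈⁺ f here = here refl
zip-∈⁺ f (there at) = there (zip-∈⁺ (f ∘ suc) at)

module _ (w : List ℕ) where
  private
    entries : List (ℕ × ℕ)
    entries = zip (upTo (length w)) w

    pair : ℕ × ℕ → ℕ × ℕ → List (ℕ × ℕ)
    pair p q = if (proj₁ p <ᵇ proj₁ q) ∧ (proj₂ q <ᵇ proj₂ p) then (proj₁ p , proj₁ q) ∷ [] else []

    pair-∈⁻ : ∀ {i j} p q → (i , j) ∈ pair p q →
              (i ≡ proj₁ p × j ≡ proj₁ q) × proj₁ p < proj₁ q × proj₂ q < proj₂ p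
    pair-∈⁻ p q ij∈ with (proj₁ p <ᵇ proj₁ q) ∧ (proj₂ q <ᵇ proj₂ p) in e
    ... | true with here refl ← ij∈ | e₁ , e₂ ← ∧-true⁻ (proj₁ p <ᵇ proj₁ q) e =
      (refl , refl) , <ᵇ-true⁻ {proj₁ p} e₁ , <ᵇ-true⁻ {proj₂ q} e₂

  invs-∈⁻ : ∀ {i j} → (i , j) ∈ invs w → Inversion w i j
  invs-∈⁻ ij∈
    with p@(_ , _) , p∈ , ij∈p ← concatMap-∈⁻ (λ p → concatMap (pair p) entries) entries ij∈
    with q@(_ , _) , q∈ , ij∈pq ← concatMap-∈⁻ (pair p) entries ij∈p
    with (refl , refl) , i<j , y<x ← pair-∈⁻ p q ij∈pq
    with _ , refl , atᵢ ← zip-∈⁻ id w p∈ | _ , refl , atⱼ ← zip-∈⁻ id w q∈ =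
    inversion atᵢ atⱼ i<j y<x

  invs-∈⁺ : ∀ {i j} → Inversion w i j → (i , j) ∈ invs w
  invs-∈⁺ {i} {j} (inversion {x} {y} atᵢ atⱼ i<j y<x) =
    concatMap-∈⁺ (λ p → concatMap (pair p) entries) (zip-∈⁺ id atᵢ)
      (concatMap-∈⁺ (pair (i , x)) (zip-∈⁺ id atⱼ) pair∈)
    where
      pair∈ : (i , j) ∈ pair (i , x) (j , y)
      pair∈ rewrite <ᵇ-true i<j | <ᵇ-true y<x = here refl

memPair⁻ : ∀ i j ps → memPair (i , j) ps ≡ true → (i , j) ∈ ps
memPair⁻ i j ps h
  with (i′ , j′) , p∈ , e ← anyB⁻ (λ p → eqℕ i (proj₁ p) ∧ eqℕ j (proj₂ p)) ps h
  with e₁ , e₂ ← ∧-true⁻ (eqℕ i i′) e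
  with refl ← eqℕ⇒≡ {i} {i′} e₁ | refl ← eqℕ⇒≡ {j} {j′} e₂ = p∈

memPair⁺ : ∀ {i j ps} → (i , j) ∈ ps → memPair (i , j) ps ≡ true
memPair⁺ {i} {j} p∈ =
  anyB⁺ (λ p → eqℕ i (proj₁ p) ∧ eqℕ j (proj₂ p)) p∈ (∧-true (eqℕ-refl i) (eqℕ-refl j))

weakLeq⁻ : ∀ u v → weakLeq u v ≡ true → ∀ {i j} → Inversion u i j → Inversion v i j
weakLeq⁻ u v h {i} {j} inv =
  invs-∈⁻ v (memPair⁻ i j (invs v) (allB⁻ (λ p → memPair p (invs v)) (invs u) h (invs-∈⁺ u inv)))

weakLeq⁺ : ∀ u v → (∀ {i j} → Inversion u i j → Inversion v i j) → weakLeq u v ≡ true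
weakLeq⁺ u v h = allB⁺ (λ p → memPair p (invs v)) (invs u) λ p∈ → memPair⁺ (invs-∈⁺ v (h (invs-∈⁻ u p∈)))

pointwise-At : ∀ {R : ℕ → ℕ → Set} u v → length u ≡ length v →
               (∀ {i x y} → At u i x → At v i y → R x y) → Pointwise R u v
pointwise-At [] [] _ h = []
pointwise-At (x ∷ u) (y ∷ v) len h =
  h here here ∷ pointwise-At u v (ℕₚ.suc-injective len) (λ p q → h (there p) (there q))

pointwise-At⁻ : ∀ {R : ℕ → ℕ → Set} {u v i x} → Pointwise R u v → At u i x → ∃ λ y → At v i y × R x y
pointwise-At⁻ (r ∷ rs) here = _ , here , r
pointwise-At⁻ (r ∷ rs) (there p) with y , q , r′ ← pointwise-At⁻ rs p = y , there q , r′

Inversion⇒⊑ : ∀ u v → length u ≡ length v → (∀ {i j} → Inversion u i j → Inversion v i j) → u ⊑ v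
Inversion⇒⊑ [] [] _ h = []
Inversion⇒⊑ (a ∷ u) (b ∷ v) len h =
  pointwise-At u v (ℕₚ.suc-injective len) head ∷ Inversion⇒⊑ u v (ℕₚ.suc-injective len) tail
  where
    head : ∀ {i x y} → At u i x → At v i y → x < a → y < b
    head p q x<a with inversion here (there q′) _ y<b ← h (inversion here (there p) z<s x<a)
      with refl ← At-functional q q′ = y<b

    tail : ∀ {i j} → Inversion u i j → Inversion v i j
    tail (inversion p q i<j y<x)
      with inversion (there p′) (there q′) _ y<x′ ← h (inversion (there p) (there q) (s<s i<j) y<x) =
      inversion p′ q′ i<j y<x′

⊑⇒Inversion : ∀ {u v} → u ⊑ v → ∀ {i j} → Inversion u i j → Inversion v i j
⊑⇒Inversion (h ∷ p) (inversion here (there q) i<j y<x) with _ , q′ , r ← pointwise-At⁻ h q =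
  inversion here (there q′) i<j (r y<x)
⊑⇒Inversion (h ∷ p) (inversion (there q₁) (there q₂) i<j y<x)
  with inversion q₁′ q₂′ _ y<x′ ← ⊑⇒Inversion p (inversion q₁ q₂ (s<s⁻¹ i<j) y<x) =
  inversion (there q₁′) (there q₂′) i<j y<x′

-- Antisymmetry of the weak order

pointwise-zip : ∀ {R R′ S : ℕ → ℕ → Set} {Q Q′ : ℕ → Set} →
                (∀ {x y} → R x y → R′ y x → Q x → Q′ y → S x y) →
                ∀ {u v} → Pointwise R u v → Pointwise R′ v u → All Q u → All Q′ v → Pointwise S u v
pointwise-zip f [] [] [] [] = []
pointwise-zip f (r ∷ rs) (r′ ∷ rs′) (q ∷ qs) (q′ ∷ qs′) = f r r′ q q′ ∷ pointwise-zip f rs rs′ qs qs′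

pointwise-zipWith : ∀ {S R : ℕ → ℕ → Set} {T : ℕ → ℕ → Set} → (∀ {x y} → S x y → R x y → T x y) →
              ∀ {u v} → Pointwise S u v → Pointwise R u v → Pointwise T u v
pointwise-zipWith f [] [] = []
pointwise-zipWith f (s ∷ ss) (r ∷ rs) = f s r ∷ pointwise-zipWith f ss rs

SameOrder : ℕ → ℕ → ℕ → ℕ → Set
SameOrder a b x y = (x <ᵇ a) ≡ (y <ᵇ b)

-- `⊑` tests only whether a later letter is smaller. For distinct letters failure of this means that
-- it is larger, so the two inclusions also fix the comparisons with earlier letters, collected in
-- `above`.
⊑-order-iso : ∀ {u v} → u ⊑ v → v ⊑ u → Unique u → Unique v →
              Pointwise (λ a b → Pointwise (SameOrder a b) u v) u v
⊑-order-iso [] [] _ _ = []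
⊑-order-iso {a ∷ u} {b ∷ v} (h ∷ p) (h′ ∷ p′) (a∉ ∷ uu) (b∉ ∷ uv) =
  (trans (<ᵇ-irrefl a) (sym (<ᵇ-irrefl b)) ∷ pointwise-zip below h h′ a∉ b∉)
  ∷ pointwise-zipWith (λ s r → s ∷ r) (pointwise-zip above h h′ a∉ b∉) (⊑-order-iso p p′ uu uv)
  where
    below : ∀ {x y} → (x < a → y < b) → (y < b → x < a) → a ≢ x → b ≢ y → SameOrder a b x y
    below f g _ _ = bool-ext (<ᵇ-true ∘ f ∘ <ᵇ-true⁻) (<ᵇ-true ∘ g ∘ <ᵇ-true⁻)

    flip< : ∀ {a b x y} → (y < b → x < a) → b ≢ y → a < x → b < y
    flip< g b≢y a<x = ℕₚ.≤∧≢⇒< (ℕₚ.≮⇒≥ (λ y<b → ℕₚ.<-asym a<x (g y<b))) b≢y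

    above : ∀ {x y} → (x < a → y < b) → (y < b → x < a) → a ≢ x → b ≢ y → SameOrder x y a b
    above f g a≢x b≢y = bool-ext (<ᵇ-true ∘ flip< g b≢y ∘ <ᵇ-true⁻) (<ᵇ-true ∘ flip< f a≢x ∘ <ᵇ-true⁻)

count<-SameOrder : ∀ a b {u v} → Pointwise (SameOrder a b) u v → count< a u ≡ count< b v
count<-SameOrder a b [] = refl
count<-SameOrder a b {x ∷ _} {y ∷ _} (e ∷ es) rewrite e with y <ᵇ b
... | true = cong suc (count<-SameOrder a b es)
... | false = count<-SameOrder a b es

-- `st` depends only on the relative order of the letters. Permutations are their own
-- standardizations, so for them this becomes equality.
⊑-antisym-st : ∀ {u v} → u ⊑ v → v ⊑ u → Unique u → Unique v → st u ≡ st v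
⊑-antisym-st p q uu uv = go (⊑-order-iso p q uu uv)
  where
    go : ∀ {u v u′ v′} → Pointwise (λ a b → Pointwise (SameOrder a b) u′ v′) u v →
         map (λ x → suc (count< x u′)) u ≡ map (λ x → suc (count< x v′)) v
    go [] = refl
    go {a ∷ _} {b ∷ _} (r ∷ rs) = cong₂ _∷_ (cong suc (count<-SameOrder a b r)) (go rs)

⊑-antisym : ∀ n {u v} → u ↭ oneTo n → v ↭ oneTo n → u ⊑ v → v ⊑ u → u ≡ v
⊑-antisym n pu pv p q = trans (sym (perm-st n pu))
  (trans (⊑-antisym-st p q (perm-unique n pu) (perm-unique n pv)) (perm-st n pv))

weakLeq⇒⊑ : ∀ n {u v} → u ↭ oneTo n → v ↭ oneTo n → weakLeq u v ≡ true → u ⊑ v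
weakLeq⇒⊑ n {u} {v} pu pv h =
  Inversion⇒⊑ u v (trans (perm-length n pu) (sym (perm-length n pv))) (weakLeq⁻ u v h)

⊑⇒weakLeq : ∀ {u v} → u ⊑ v → weakLeq u v ≡ true
⊑⇒weakLeq {u} {v} p = weakLeq⁺ u v (⊑⇒Inversion p)

weak-poset : ∀ n → IsFinitePoset (perms n) weakLeq eqList
weak-poset n = record
  { unique  = perms-unique n
  ; eq-refl = eqList-refl
  ; eq⇒≡    = eqList⇒≡
  ; reflex  = λ {u} _ → weakLeq⁺ u u id
  ; transit = λ {u} {v} {w} _ _ _ p q → weakLeq⁺ u w (weakLeq⁻ v w q ∘ weakLeq⁻ u v p)
  ; antisym = λ u∈ v∈ p q → let pu = ∈perms⁻ n u∈ ; pv = ∈perms⁻ n v∈ in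
      ⊑-antisym n pu pv (weakLeq⇒⊑ n pu pv p) (weakLeq⇒⊑ n pv pu q)
  }

-- The adjunction between `lam` and `maxPerm`

maxPerm-perm : ∀ n {t} → t ∈ trees n → maxPerm t ↭ oneTo n
maxPerm-perm n {t} t∈ = subst (λ k → maxPerm t ↭ oneTo k) (∈trees⁻ n t∈) (maxPerm-↭ t)

lam∈trees : ∀ n {σ} → σ ∈ perms n → lam σ ∈ trees n
lam∈trees n σ∈ = ∈trees⁺ (trans (LamGraph-size (lam-graph n p)) (perm-length n p))
  where p = ∈perms⁻ n σ∈

lam-maxPerm-adjoint : ∀ n (_≤T?_ : Decidable _≤T_) {σ t} → σ ∈ perms n → t ∈ trees n →
                      ⌊ lam σ ≤T? t ⌋ ≡ weakLeq σ (maxPerm t)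
lam-maxPerm-adjoint n _≤T?_ {σ} {t} σ∈ t∈ = bool-ext
  (λ h → ⊑⇒weakLeq (Compatible⇒⊑
    (Compatible-≤T (⌊⌋⇒ (lam σ ≤T? t) h) (LamGraph⇒Compatible (lam-graph n p)))))
  (λ h → ⇒⌊⌋ (lam σ ≤T? t) (LamGraph-≤T (lam-graph n p)
    (⊑⇒Compatible t (perm-unique n p) (weakLeq⇒⊑ n p (maxPerm-perm n t∈) h))))
  where p = ∈perms⁻ n σ∈

lam-maxPerm : ∀ n {t} → t ∈ trees n → lam (maxPerm t) ≡ t
lam-maxPerm n {t} t∈ = LamGraph-functional (lam-graph n (maxPerm-perm n t∈)) (LamGraph-maxPerm t)

module Λ-Galois (n : ℕ) (_≤T?_ : Decidable _≤T_) =
  Galois (weak-poset n) (tamari-poset n _≤T?_) lam maxPerm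
    (lam∈trees n) (∈perms⁺ n ∘ maxPerm-perm n) (lam-maxPerm-adjoint n _≤T?_) (lam-maxPerm n)

-- 132-avoidance

-- Sublists replace indices because they split along `++` and pull back along `map`, following the
-- shape of `maxPerm`.
Pattern132 : List ℕ → Set
Pattern132 w = ∃ λ x → ∃ λ y → ∃ λ z → x ∷ y ∷ z ∷ [] ⊆ w × x < z × z < y

⊆-++⁻ : ∀ {xs : List ℕ} u {v} → xs ⊆ u ++ v → ∃ λ as → ∃ λ bs → xs ≡ as ++ bs × as ⊆ u × bs ⊆ v
⊆-++⁻ [] s = [] , _ , refl , [] , s
⊆-++⁻ (a ∷ u) (_ ∷ʳ s) with as , bs , refl , sa , sb ← ⊆-++⁻ u s = as , bs , refl , a ∷ʳ sa , sb
⊆-++⁻ (a ∷ u) (refl ∷ s) with as , bs , refl , sa , sb ← ⊆-++⁻ u s = a ∷ as , bs , refl , refl ∷ sa , sb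

⊆-second : ∀ {x y : ℕ} {w} → x ∷ y ∷ [] ⊆ w → y ∈ w
⊆-second (_ ∷ʳ s) = there (⊆-second s)
⊆-second (_ ∷ s) = there (to∈ s)

⊆-map⁻ : ∀ (f : ℕ → ℕ) {xs} w → xs ⊆ map f w → ∃ λ xs′ → xs ≡ map f xs′ × xs′ ⊆ w
⊆-map⁻ f [] [] = [] , refl , []
⊆-map⁻ f (a ∷ w) (_ ∷ʳ s) with xs′ , refl , s′ ← ⊆-map⁻ f w s = xs′ , refl , a ∷ʳ s′
⊆-map⁻ f (a ∷ w) (refl ∷ s) with xs′ , refl , s′ ← ⊆-map⁻ f w s = a ∷ xs′ , refl , refl ∷ s′

Pattern132-shift⁻ : ∀ q w → Pattern132 (map (q ℕ.+_) w) → Pattern132 w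
Pattern132-shift⁻ q w (_ , _ , _ , s , x<z , z<y)
  with x ∷ y ∷ z ∷ [] , refl , s′ ← ⊆-map⁻ (q ℕ.+_) w s =
  x , y , z , s′ , ℕₚ.+-cancelˡ-< q x z x<z , ℕₚ.+-cancelˡ-< q z y z<y

-- The left block exceeds the right one and the root letter exceeds both. A pattern starting left
-- cannot end right, as `x < z`, nor at the root, as `z < y`; one starting at the root would have
-- its largest letter first. So it lies within one block.
maxPerm-avoids : ∀ t → ¬ Pattern132 (maxPerm t)
maxPerm-avoids leaf (_ , _ , _ , () , _)
maxPerm-avoids (l ∨T r) (x , y , z , s , x<z , z<y) with ⊆-++⁻ (map (size r ℕ.+_) (maxPerm l)) s
... | [] , _ , refl , _ , (_ ∷ʳ s′) = maxPerm-avoids r (x , y , z , s′ , x<z , z<y)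
... | [] , _ , refl , _ , (refl ∷ s′) = ℕₚ.<-asym x<z (All.lookup (maxPerm-right< l r) (⊆-second s′))
... | _ ∷ [] , _ , refl , sx , (_ ∷ʳ s′) =
  ℕₚ.<-asym x<z (All.lookup (All.lookup (maxPerm-right<left l r) (to∈ sx)) (⊆-second s′))
... | _ ∷ [] , _ , refl , sx , (refl ∷ s′) =
  ℕₚ.<-asym x<z (All.lookup (All.lookup (maxPerm-right<left l r) (to∈ sx)) (to∈ s′))
... | _ ∷ _ ∷ [] , _ , refl , sxy , (_ ∷ʳ s′) =
  ℕₚ.<-asym x<z (All.lookup (All.lookup (maxPerm-right<left l r) (to∈ sxy)) (to∈ s′))
... | _ ∷ _ ∷ [] , _ , refl , sxy , (refl ∷ s′) =
  ℕₚ.<-asym z<y (All.lookup (maxPerm-left< l r) (⊆-second sxy))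
... | _ ∷ _ ∷ _ ∷ [] , _ , refl , s′ , _ = maxPerm-avoids l (Pattern132-shift⁻ (size r) (maxPerm l) (x , y , z , s′ , x<z , z<y))

-- If some `x` in `u` were smaller than some `z` in `v`, then `x`, `m`, `z` would form the pattern
-- 132. Hence `u` lies entirely above `v`, which is what `⊑-node` asks of its larger word.
avoiding-maximal : ∀ {w t} → LamGraph w t → Unique w → ¬ Pattern132 w → maxPerm t ⊑ w
avoiding-maximal leaf _ _ = []
avoiding-maximal (node {u} {m} {v} {l} {r} u< v< gl gr) uw av with uu , _ ∷ uv , distinct ← unique-++⁻ u uw =
  ⊑-node (maxPerm-left< l r)
    (⊑-shiftˡ⁺ (size r) (avoiding-maximal gl uu
      λ (x , y , z , s , p) → av (x , y , z , ⊆ₚ.++⁺ʳ (m ∷ v) s , p)))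
    (avoiding-maximal gr uv λ (x , y , z , s , p) → av (x , y , z , ⊆ₚ.++⁺ˡ u (m ∷ʳ s) , p))
    (All.tabulate λ x∈ → All.tabulate λ z∈ → ℕₚ.≤∧≢⇒<
      (ℕₚ.≮⇒≥ λ x<z → av (_ , m , _ , ⊆ₚ.++⁺ (from∈ x∈) (refl ∷ from∈ z∈) , x<z , All.lookup v< z∈))
      (≢-sym (distinct x∈ (there z∈))))
    v<

⊆⇒lookup₁ : ∀ {x : ℕ} w → x ∷ [] ⊆ w → ∃ λ k → lookup w k ≡ x
⊆⇒lookup₁ (_ ∷ w) (_ ∷ʳ s) with k , e ← ⊆⇒lookup₁ w s = Fin.suc k , e
⊆⇒lookup₁ (_ ∷ w) (refl ∷ s) = Fin.zero , refl

⊆⇒lookup₂ : ∀ {x y : ℕ} w → x ∷ y ∷ [] ⊆ w → ∃ λ j → ∃ λ k → j Fin.< k × lookup w j ≡ x × lookup w k ≡ y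
⊆⇒lookup₂ (_ ∷ w) (_ ∷ʳ s) with j , k , j<k , e ← ⊆⇒lookup₂ w s = Fin.suc j , Fin.suc k , s<s j<k , e
⊆⇒lookup₂ (_ ∷ w) (refl ∷ s) with k , e ← ⊆⇒lookup₁ w s = Fin.zero , Fin.suc k , z<s , refl , e

⊆⇒lookup₃ : ∀ {x y z : ℕ} w → x ∷ y ∷ z ∷ [] ⊆ w → ∃ λ i → ∃ λ j → ∃ λ k →
            i Fin.< j × j Fin.< k × lookup w i ≡ x × lookup w j ≡ y × lookup w k ≡ z
⊆⇒lookup₃ (_ ∷ w) (_ ∷ʳ s) with i , j , k , i<j , j<k , e ← ⊆⇒lookup₃ w s =
  Fin.suc i , Fin.suc j , Fin.suc k , s<s i<j , s<s j<k , e
⊆⇒lookup₃ (_ ∷ w) (refl ∷ s) with j , k , j<k , e ← ⊆⇒lookup₂ w s =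
  Fin.zero , Fin.suc j , Fin.suc k , z<s , s<s j<k , refl , e

lookup⇒⊆₂ : ∀ (w : List ℕ) j k → j Fin.< k → lookup w j ∷ lookup w k ∷ [] ⊆ w
lookup⇒⊆₂ (_ ∷ w) Fin.zero (Fin.suc k) _ = refl ∷ from∈ (∈ₚ.∈-lookup k)
lookup⇒⊆₂ (_ ∷ w) (Fin.suc j) (Fin.suc k) j<k = _ ∷ʳ lookup⇒⊆₂ w j k (s<s⁻¹ j<k)

lookup⇒⊆₃ : ∀ (w : List ℕ) i j k → i Fin.< j → j Fin.< k → lookup w i ∷ lookup w j ∷ lookup w k ∷ [] ⊆ w
lookup⇒⊆₃ (_ ∷ w) Fin.zero (Fin.suc j) (Fin.suc k) _ j<k = refl ∷ lookup⇒⊆₂ w j k (s<s⁻¹ j<k)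
lookup⇒⊆₃ (_ ∷ w) (Fin.suc i) (Fin.suc j) (Fin.suc k) i<j j<k =
  _ ∷ʳ lookup⇒⊆₃ w i j k (s<s⁻¹ i<j) (s<s⁻¹ j<k)

Avoids132⇒¬Pattern132 : ∀ {w} → Avoids132 w → ¬ Pattern132 w
Avoids132⇒¬Pattern132 {w} av (x , y , z , s , x<z , z<y)
  with i , j , k , i<j , j<k , refl , refl , refl ← ⊆⇒lookup₃ w s = av (i , j , k , i<j , j<k , x<z , z<y)

¬Pattern132⇒Avoids132 : ∀ {w} → ¬ Pattern132 w → Avoids132 w
¬Pattern132⇒Avoids132 {w} av (i , j , k , i<j , j<k , x<z , z<y) =
  av (_ , _ , _ , lookup⇒⊆₃ w i j k i<j j<k , x<z , z<y)

avoiding≡maxPerm : ∀ n {σ} → σ ↭ oneTo n → Avoids132 σ → σ ≡ maxPerm (lam σ)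
avoiding≡maxPerm n {σ} p av =
  ⊑-antisym n p (maxPerm-perm n (lam∈trees n (∈perms⁺ n p)))
    (Compatible⇒⊑ (LamGraph⇒Compatible g))
    (avoiding-maximal g (perm-unique n p) (Avoids132⇒¬Pattern132 av))
  where g = lam-graph n p

theorem3p1 : (n : ℕ) (_≤T?_ : Decidable _≤T_) →
    ((σ : List ℕ) → σ ↭ oneTo n →
    (Avoids132 σ → Λ (Mσ n σ) ≈Y Mt n _≤T?_ (lam σ))
    × (¬ Avoids132 σ → Λ (Mσ n σ) ≈Y []))
    × ((t : Tree) → size t ≡ n →
    ((∃ λ S → S ∈ subsetsQ n × t ≡ C n S) → 𝓛 (Mt n _≤T?_ t) ≈Q MS n (Lset t))
    × (¬ (∃ λ S → S ∈ subsetsQ n × t ≡ C n S) → 𝓛 (Mt n _≤T?_ t) ≈Q []))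
theorem3p1 n _≤T?_ =
  (λ σ p →
    (λ av → Λ-Galois.Mono-image n _≤T?_ (∈perms⁺ n p) (avoiding≡maxPerm n p av)) ,
    (λ ¬av → Λ-Galois.Mono-non-image n _≤T?_ (∈perms⁺ n p)
      λ { {t} _ refl → ¬av (¬Pattern132⇒Avoids132 (maxPerm-avoids t)) })) ,
  (λ t size≡n →
    (λ { (S , S∈ , refl) → 𝓛-Galois.Mono-image n _≤T?_ (∈trees⁺ size≡n) (cong (C n) (sym (Lset-C n S∈))) }) ,
    (λ ¬im → 𝓛-Galois.Mono-non-image n _≤T?_ (∈trees⁺ size≡n) λ {S} S∈ t≡ → ¬im (S , S∈ , t≡)))
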